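{- Let $L$ be a countable bounded distributive lattice, and let $X$ be its Priestley space (which is then metrizable). (1) $X$ is not a p-space if and only if one of $Z_1,Z_2,Z_3$ is a p-configuration for $X$; that is, if and only if there exist $i\in\{1,2,3\}$, a map $e\colon Z_i\to X$ that is both a topological embedding and an order embedding, and an open upset $U$ of $X$ with $e(y)\in U$ such that $e^{ -1}({\downarrow}U)=\{x,y\}$. (2) $L$ is not a p-algebra if and only if there is $i\in\{1,2,3\}$ such that $L_i$ is a homomorphic image of $L$ via an onto bounded lattice homomorphism $h_i\colon L\to L_i$ with the following property: there is $a\in L$ such that $h_i[I_{a\to 0}]=I_{c_i\to 0}$, where $c_1=c$, $c_2=\{0\}$, and $c_3=(\varnothing,1)$.
   Context: For a poset $X$ and $A\subseteq X$, ${\downarrow}A=\{x\mid x\le a\text{ for some }a\in A\}$ and ${\uparrow}A=\{x\mid a\le x\text{ for some }a\in A\}$; $A$ is an upset if ${\uparrow}A=A$. A Priestley space is a compact topological space $X$ with a partial order such that whenever $x\nleq y$ there is a clopen upset $U$ with $x\in U$, $y\notin U$. The Priestley space of a bounded distributive lattice $L$ is the set of prime filters of $L$ ordered by inclusion, with topology generated by the basis $\{\alpha(a)\setminus\alpha(b)\mid a,b\in L\}$, where $\alpha(a)$ is the set of prime filters containing $a$. "Countable" includes finite. A p-algebra is a pseudocomplemented distributive lattice: a bounded distributive lattice in which for each $a$ there is a largest element $d$ with $d\wedge a=0$. A p-space is a Priestley space in which the downset of each open upset is open. For $a,b$ in a bounded distributive lattice $L$, $I_{a\to b}:=\{d\in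 L\mid d\wedge a\le b\}$. In $I_{c_i\to 0}$, this is computed in $L_i$, with $0$ the bottom of $L_i$. The Priestley spaces $Z_1,Z_2,Z_3$ have the same underlying topological space: the one-point compactification of the countable discrete space $\{y\}\cup\{z_n\mid n\in\omega\}$ (all points distinct), where $x$ is the added point. Their orders have exactly the following strict relations. - $Z_1$: $x<y$; $z_0>z_1>z_2>\cdots$; $x<z_n$ for all $n$. - $Z_2$: $x<y$ and $x<z_n$ for all $n$. - $Z_3$: $x<y$ only. The lattices $L_i$ and elements $c_i$ are as follows. - $L_1$ is the lattice of clopen upsets of $Z_1$, i.e. $\varnothing$, $\{y\}$, ${\uparrow}z_n=\{z_0,\dots,z_n\}$, ${\uparrow}z_n\cup\{y\}$ ($n\in\omega$), and $Z_1$, under inclusion; $c=\{y\}$. - $L_2$ is the lattice $\mathcal{P}_{\rm fin}(\omega)$ of finite subsets of $\omega$ under inclusion together with an added top element; $c_2=\{0\}$ is the singleton of the number $0\in\omega$. - $L_3$ is the bounded sublattice of ${\bf CF}(\omega)\times{\bf 2}$ consisting of the pairs $(A,n)$ with $A$ finite or $n=1$, where ${\bf CF}(\omega)$ is the Boolean algebra of finite and cofinite subsets of $\omega$ and ${\bf 2}=\{0,1\}$; $c_3=(\varnothing,1)$. -}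

module Defs where

open import Algebra.Lattice.Bundles using (RawLattice)
open import Algebra.Lattice.Morphism.Structures using (module LatticeMorphisms)
open import Data.Bool.Base as Bool using (Bool; true; false)
import Data.Bool.Properties as Bool
open import Data.Empty using (⊥-elim)
open import Data.List.Base using (List; []; _∷_; _++_; map)
import Data.List.Membership.Propositional as List
open import Data.List.Membership.DecPropositional using () renaming (_∈?_ to ∈?)
open import Data.List.Membership.Propositional.Properties
  using (∈-++⁺ˡ; ∈-++⁺ʳ; ∈-++⁻; ∈-map⁺; ∈-map⁻)
open import Data.List.Properties using (map-++)
open import Data.List.Relation.Unary.Any using (Any; here)
open import Data.Maybe.Base using (Maybe; just; nothing)
open import Data.Nat.Base as ℕ using (ℕ)
import Data.Nat.Properties as ℕ
open import Data.Product.Base using (∃; _×_; _,_; proj₁; proj₂)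
open import Data.Product.Relation.Binary.Pointwise.NonDependent
  using (Pointwise; ×-isPartialOrder)
open import Data.Sum.Base as Sum using (_⊎_; inj₁; inj₂; [_,_]′)
open import Function.Base using (_∘_; _on_; id)
open import Function.Bundles using (Injection)
open import Function.Definitions using (Injective; Surjective)
open import Level using (Level; suc; _⊔_; 0ℓ; lift)
open import Relation.Binary.Bundles using (Poset; Setoid)
open import Relation.Binary.Core using (Rel)
open import Relation.Binary.Definitions using (_Respects_)
open import Relation.Binary.Lattice.Bundles using (BoundedLattice)
open import Relation.Binary.Morphism.Structures using (IsOrderMonomorphism)
open import Relation.Binary.PropositionalEquality
  using (_≡_; refl; sym; subst; resp₂; setoid; isEquivalence)
open import Relation.Binary.Structures
  using (IsStrictPartialOrder)
import Relation.Binary.Construct.On as On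
import Relation.Binary.Construct.StrictToNonStrict as ToNonStrict
import Relation.Binary.Construct.Add.Supremum.Equality as Eq⁺
import Relation.Binary.Construct.Add.Supremum.NonStrict as Order⁺
open import Relation.Nullary using (¬_; yes; no; contradiction)
open import Relation.Nullary.Construct.Add.Supremum using (_⁺; ⊤⁺; [_])
open import Relation.Nullary.Decidable using (_×-dec_; _⊎-dec_)
open import Relation.Unary
  using (Pred; Decidable; _∈_; _∉_; _⊆_; _≐_; _∪_; _∩_; _∖_; ∁; _⊢_; ｛_｝)
import Relation.Unary.Polymorphic as Poly
open import Relation.Unary.Relation.Binary.Subset using (⊆-isPartialOrder)

record BoundedDistributiveLattice (c ℓ₁ ℓ₂ : Level) : Set (suc (c ⊔ ℓ₁ ⊔ ℓ₂)) where
  field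
    boundedLattice : BoundedLattice c ℓ₁ ℓ₂
  open BoundedLattice boundedLattice public
  field
    ∧-distribˡ-∨ : ∀ a b d → (a ∧ (b ∨ d)) ≈ ((a ∧ b) ∨ (a ∧ d))

  rawLattice : RawLattice c ℓ₁
  rawLattice = record { _≈_ = _≈_ ; _∧_ = _∧_ ; _∨_ = _∨_ }

-- Finite sets inject into ℕ, so "countable" includes "finite".
Countable : ∀ {c ℓ} → Setoid c ℓ → Set (c ⊔ ℓ)
Countable S = Injection S (setoid ℕ)

module _ {c ℓ₁ ℓ₂ : Level} (L : BoundedDistributiveLattice c ℓ₁ ℓ₂) where
  open BoundedDistributiveLattice L

  I[_⟶_] : Carrier → Carrier → Pred Carrier ℓ₂
  I[ a ⟶ b ] d = (d ∧ a) ≤ b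

  IsPAlgebra : Set (c ⊔ ℓ₁ ⊔ ℓ₂)
  IsPAlgebra = ∀ a → ∃ λ d →
    ((d ∧ a) ≈ ⊥) × (∀ e → (e ∧ a) ≈ ⊥ → e ≤ d)

module _ {c ℓ₁ ℓ₂ c′ ℓ₁′ ℓ₂′ : Level}
         (L : BoundedDistributiveLattice c ℓ₁ ℓ₂)
         (M : BoundedDistributiveLattice c′ ℓ₁′ ℓ₂′) where
  private
    module L = BoundedDistributiveLattice L
    module M = BoundedDistributiveLattice M

  record IsBoundedLatticeEpimorphism (h : L.Carrier → M.Carrier)
         : Set (c ⊔ ℓ₁ ⊔ c′ ⊔ ℓ₁′) where
    open LatticeMorphisms L.rawLattice M.rawLattice
    field
      isLatticeHomomorphism : IsLatticeHomomorphism h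
      ⊤-homo                : h L.⊤ M.≈ M.⊤
      ⊥-homo                : h L.⊥ M.≈ M.⊥
      surjective            : Surjective L._≈_ M._≈_ h

  Image : ∀ {p} → (L.Carrier → M.Carrier) → Pred L.Carrier p → Pred M.Carrier (c ⊔ ℓ₁′ ⊔ p)
  Image h S b = ∃ λ a → (a ∈ S) × (h a M.≈ b)

  IsPQuotient : M.Carrier → Set (c ⊔ ℓ₁ ⊔ ℓ₂ ⊔ c′ ⊔ ℓ₁′ ⊔ ℓ₂′)
  IsPQuotient m = ∃ λ (h : L.Carrier → M.Carrier) →
    IsBoundedLatticeEpimorphism h ×
    (∃ λ a → Image h (I[_⟶_] L a L.⊥) ≐ I[_⟶_] M m M.⊥)

-- The topology is given by a base.  Equality is a setoid equality, since
-- points may themselves be subsets (prime filters).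
record OrderedSpace (c ℓ₁ ℓ₂ b p : Level) : Set (suc (c ⊔ ℓ₁ ⊔ ℓ₂ ⊔ b ⊔ p)) where
  field
    poset : Poset c ℓ₁ ℓ₂
  open Poset poset public
  field
    Base   : Set b
    ⟦_⟧    : Base → Pred Carrier p
    resp   : ∀ B → ⟦ B ⟧ Respects _≈_
    covers : ∀ x → ∃ λ B → x ∈ ⟦ B ⟧
    refine : ∀ B C {x} → x ∈ ⟦ B ⟧ → x ∈ ⟦ C ⟧ →
             ∃ λ D → (x ∈ ⟦ D ⟧) × (⟦ D ⟧ ⊆ (⟦ B ⟧ ∩ ⟦ C ⟧))

  -- Level at which "all subsets" are quantified over; by excluded middle
  -- every subset has an equivalent one at any given level.
  size : Level
  size = c ⊔ ℓ₁ ⊔ ℓ₂ ⊔ b ⊔ p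

  Open : ∀ {q} → Pred Carrier q → Set (c ⊔ b ⊔ p ⊔ q)
  Open S = ∀ {x} → x ∈ S → ∃ λ B → (x ∈ ⟦ B ⟧) × (⟦ B ⟧ ⊆ S)

  -- Decidability is automatic by excluded middle.  It is included so that
  -- clopen sets are constructively closed under union and intersection.
  Clopen : ∀ {q} → Pred Carrier q → Set (c ⊔ b ⊔ p ⊔ q)
  Clopen S = Decidable S × Open S × Open (∁ S)

  ↓_ : ∀ {q} → Pred Carrier q → Pred Carrier (c ⊔ ℓ₂ ⊔ q)
  (↓ A) x = ∃ λ a → (a ∈ A) × (x ≤ a)

  ↑_ : ∀ {q} → Pred Carrier q → Pred Carrier (c ⊔ ℓ₂ ⊔ q)
  (↑ A) x = ∃ λ a → (a ∈ A) × (a ≤ x)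

  Upset : ∀ {q} → Pred Carrier q → Set (c ⊔ ℓ₂ ⊔ q)
  Upset A = (↑ A) ≐ A

  Compact : Set (suc size)
  Compact = ∀ {I : Set size} (S : I → Pred Carrier size) → (∀ i → Open (S i)) →
            (∀ x → ∃ λ i → x ∈ S i) →
            ∃ λ (is : List I) → ∀ x → Any (λ i → x ∈ S i) is

  IsPriestleySpace : Set (suc size)
  IsPriestleySpace = Compact ×
    (∀ {x y} → ¬ (x ≤ y) → ∃ λ (S : Pred Carrier size) →
       Clopen S × Upset S × (x ∈ S) × (y ∉ S))

  IsPSpace : Set (suc size)
  IsPSpace = IsPriestleySpace ×
    (∀ (S : Pred Carrier size) → Open S → Upset S → Open (↓ S))

module _ {c ℓ₁ ℓ₂ b p c′ ℓ₁′ ℓ₂′ b′ p′ : Level}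
         (Z : OrderedSpace c ℓ₁ ℓ₂ b p) (X : OrderedSpace c′ ℓ₁′ ℓ₂′ b′ p′) where
  private
    module Z = OrderedSpace Z
    module X = OrderedSpace X

  IsOrderEmbedding : (Z.Carrier → X.Carrier) → Set (c ⊔ ℓ₁ ⊔ ℓ₂ ⊔ ℓ₁′ ⊔ ℓ₂′)
  IsOrderEmbedding = IsOrderMonomorphism Z._≈_ X._≈_ Z._≤_ X._≤_

  -- A homeomorphism onto the image with its subspace topology.
  record IsTopologicalEmbedding (e : Z.Carrier → X.Carrier)
         : Set (suc (Z.size ⊔ X.size)) where
    field
      cong       : ∀ {u v} → u Z.≈ v → e u X.≈ e v
      injective  : Injective Z._≈_ X._≈_ e
      continuous : ∀ (S : Pred X.Carrier X.size) → X.Open S → Z.Open (e ⊢ S)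
      open-image : ∀ (T : Pred Z.Carrier Z.size) → Z.Open T →
                   ∃ λ (S : Pred X.Carrier X.size) → X.Open S × (T ≐ (e ⊢ S))

module _ {c ℓ₁ ℓ₂ : Level} (L : BoundedDistributiveLattice c ℓ₁ ℓ₂) where
  open BoundedDistributiveLattice L

  record PrimeFilter : Set (suc (c ⊔ ℓ₁ ⊔ ℓ₂)) where
    field
      Member   : Pred Carrier (c ⊔ ℓ₁ ⊔ ℓ₂)
      ⊤-member : ⊤ ∈ Member
      upward   : ∀ {a b} → a ≤ b → a ∈ Member → b ∈ Member
      ∧-closed : ∀ {a b} → a ∈ Member → b ∈ Member → (a ∧ b) ∈ Member
      proper   : ⊥ ∉ Member
      prime    : ∀ {a b} → (a ∨ b) ∈ Member → (a ∈ Member) ⊎ (b ∈ Member)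

  open PrimeFilter

  α : Carrier → Pred PrimeFilter (c ⊔ ℓ₁ ⊔ ℓ₂)
  α a F = a ∈ Member F

  PriestleySpace : OrderedSpace (suc (c ⊔ ℓ₁ ⊔ ℓ₂)) (c ⊔ ℓ₁ ⊔ ℓ₂) (c ⊔ ℓ₁ ⊔ ℓ₂)
                                c (c ⊔ ℓ₁ ⊔ ℓ₂)
  PriestleySpace = record
    { poset = record
      { Carrier = PrimeFilter
      ; _≈_ = λ F G → Member F ≐ Member G
      ; _≤_ = λ F G → Member F ⊆ Member G
      ; isPartialOrder = On.isPartialOrder Member ⊆-isPartialOrder
      }
    ; Base = Carrier × Carrier
    ; ⟦_⟧ = λ (a , b) → α a ∖ α b
    ; resp = λ _ F≈G (a∈F , b∉F) → proj₁ F≈G a∈F , b∉F ∘ proj₂ F≈G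
    ; covers = λ F → (⊤ , ⊥) , ⊤-member F , proper F
    ; refine = λ { (a , b) (a′ , b′) {F} (a∈F , b∉F) (a′∈F , b′∉F) →
        (a ∧ a′ , b ∨ b′)
        , (∧-closed F a∈F a′∈F , [ b∉F , b′∉F ]′ ∘ prime F)
        , λ {G} (m , n) →
            (upward G (x∧y≤x a a′) m , n ∘ upward G (x≤x∨y b b′)) ,
            (upward G (x∧y≤y a a′) m , n ∘ upward G (y≤x∨y b b′)) }
    }

-- One-point compactification of the discrete space D, with the added point
-- `nothing`, and with a partial order.  Basic opens: the singletons ｛ just d ｝
-- and the complements of the finite subsets of D.
module _ {D : Set} (_<_ : Rel (Maybe D) 0ℓ) (isSPO : IsStrictPartialOrder _≡_ _<_) where

  private
    basic : D ⊎ List D → Pred (Maybe D) 0ℓ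
    basic (inj₁ d)  = ｛ just d ｝
    basic (inj₂ ds) = λ u → ¬ (u List.∈ map just ds)

    basic-refine : ∀ B C {u} → u ∈ basic B → u ∈ basic C →
                   ∃ λ E → (u ∈ basic E) × (basic E ⊆ (basic B ∩ basic C))
    basic-refine (inj₁ d)  C         refl v = inj₁ d , refl , λ { refl → refl , v }
    basic-refine (inj₂ ds) (inj₁ d)  u refl = inj₁ d , refl , λ { refl → u , refl }
    basic-refine (inj₂ ds) (inj₂ es) {w} u v =
      inj₂ (ds ++ es)
      , (λ m → [ u , v ]′ (∈-++⁻ (map just ds) (subst (w List.∈_) (map-++ just ds es) m)))
      , λ {w′} n →
          (λ m → n (subst (w′ List.∈_) (sym (map-++ just ds es)) (∈-++⁺ˡ m))) ,
          (λ m → n (subst (w′ List.∈_) (sym (map-++ just ds es)) (∈-++⁺ʳ (map just ds) m)))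

  orderedCompactification : OrderedSpace 0ℓ 0ℓ 0ℓ 0ℓ 0ℓ
  orderedCompactification = record
    { poset = record
      { Carrier = Maybe D
      ; _≈_ = _≡_
      ; _≤_ = ToNonStrict._≤_ _≡_ _<_
      ; isPartialOrder = ToNonStrict.isPartialOrder _≡_ _<_ isSPO
      }
    ; Base = D ⊎ List D
    ; ⟦_⟧ = basic
    ; resp = λ { _ refl → id }
    ; covers = λ _ → inj₂ [] , λ ()
    ; refine = basic-refine
    }

data Isolated : Set where
  y′ : Isolated
  z′ : ℕ → Isolated

Point : Set
Point = Maybe Isolated

pattern x   = nothing
pattern y   = just y′
pattern z n = just (z′ n)

data _<₁_ : Rel Point 0ℓ where
  x<y : x <₁ y
  x<z : ∀ {n} → x <₁ z n
  z<z : ∀ {m n} → m ℕ.< n → z n <₁ z m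

data _<₂_ : Rel Point 0ℓ where
  x<y : x <₂ y
  x<z : ∀ {n} → x <₂ z n

data _<₃_ : Rel Point 0ℓ where
  x<y : x <₃ y

<₁-isStrictPartialOrder : IsStrictPartialOrder _≡_ _<₁_
<₁-isStrictPartialOrder = record
  { isEquivalence = isEquivalence
  ; irrefl = λ { refl (z<z m<m) → ℕ.<-irrefl refl m<m }
  ; trans = λ { x<z (z<z _) → x<z ; (z<z p) (z<z q) → z<z (ℕ.<-trans q p) }
  ; <-resp-≈ = resp₂ _<₁_
  }

<₂-isStrictPartialOrder : IsStrictPartialOrder _≡_ _<₂_
<₂-isStrictPartialOrder = record
  { isEquivalence = isEquivalence
  ; irrefl = λ { refl () }
  ; trans = λ { x<y () ; x<z () }
  ; <-resp-≈ = resp₂ _<₂_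
  }

<₃-isStrictPartialOrder : IsStrictPartialOrder _≡_ _<₃_
<₃-isStrictPartialOrder = record
  { isEquivalence = isEquivalence
  ; irrefl = λ { refl () }
  ; trans = λ { x<y () }
  ; <-resp-≈ = resp₂ _<₃_
  }

Z₁ Z₂ Z₃ : OrderedSpace 0ℓ 0ℓ 0ℓ 0ℓ 0ℓ
Z₁ = orderedCompactification _<₁_ <₁-isStrictPartialOrder
Z₂ = orderedCompactification _<₂_ <₂-isStrictPartialOrder
Z₃ = orderedCompactification _<₃_ <₃-isStrictPartialOrder

module _ {c ℓ₁ ℓ₂ b p c′ ℓ₁′ ℓ₂′ b′ p′ : Level}
         (Z : OrderedSpace c ℓ₁ ℓ₂ b p) (u v : OrderedSpace.Carrier Z)
         (X : OrderedSpace c′ ℓ₁′ ℓ₂′ b′ p′) where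
  private
    module Z = OrderedSpace Z
    module X = OrderedSpace X

  -- Z is a p-configuration for X, where the points u and v of Z play the
  -- roles of x and y.
  IsPConfiguration : Set (suc (Z.size ⊔ X.size))
  IsPConfiguration = ∃ λ (e : Z.Carrier → X.Carrier) →
    IsTopologicalEmbedding Z X e × IsOrderEmbedding Z X e ×
    (∃ λ (S : Pred X.Carrier X.size) →
       X.Open S × X.Upset S × (e v ∈ S) ×
       ((e ⊢ (X.↓ S)) ≐ (λ w → (w Z.≈ u) ⊎ (w Z.≈ v))))

Powerset : ∀ {a} → Set a → (ℓ : Level) → BoundedDistributiveLattice (a ⊔ suc ℓ) (a ⊔ ℓ) (a ⊔ ℓ)
Powerset A ℓ = record
  { boundedLattice = record
    { Carrier = Pred A ℓ
    ; _≈_ = _≐_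
    ; _≤_ = _⊆_
    ; _∨_ = _∪_
    ; _∧_ = _∩_
    ; ⊤ = Poly.U
    ; ⊥ = Poly.∅
    ; isBoundedLattice = record
      { isLattice = record
        { isPartialOrder = ⊆-isPartialOrder
        ; supremum = λ _ _ → inj₁ , inj₂ , λ _ f g → [ f , g ]′
        ; infimum = λ _ _ → proj₁ , proj₂ , λ _ f g r → f r , g r
        }
      ; maximum = λ _ _ → _
      ; minimum = λ _ ()
      }
    }
  ; ∧-distribˡ-∨ = λ _ _ _ →
      (λ (a , s) → Sum.map (a ,_) (a ,_) s) ,
      [ (λ (a , b) → a , inj₁ b) , (λ (a , d) → a , inj₂ d) ]′
  }

𝟚 : BoundedDistributiveLattice 0ℓ 0ℓ 0ℓ
𝟚 = record
  { boundedLattice = record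
    { Carrier = Bool
    ; _≈_ = _≡_
    ; _≤_ = Bool._≤_
    ; _∨_ = Bool._∨_
    ; _∧_ = Bool._∧_
    ; ⊤ = true
    ; ⊥ = false
    ; isBoundedLattice = record
      { isLattice = record
        { isPartialOrder = Bool.≤-isPartialOrder
        ; supremum = λ
          { false b → Bool.≤-minimum b , Bool.≤-refl , λ _ _ q → q
          ; true  b → Bool.≤-refl , Bool.≤-maximum b , λ _ p _ → p }
        ; infimum = λ
          { false b → Bool.≤-refl , Bool.≤-minimum b , λ _ p _ → p
          ; true  b → Bool.≤-maximum b , Bool.≤-refl , λ _ _ q → q }
        }
      ; maximum = Bool.≤-maximum
      ; minimum = Bool.≤-minimum
      }
    }
  ; ∧-distribˡ-∨ = Bool.∧-distribˡ-∨
  }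

_×ᴸ_ : ∀ {c ℓ₁ ℓ₂ c′ ℓ₁′ ℓ₂′} →
       BoundedDistributiveLattice c ℓ₁ ℓ₂ → BoundedDistributiveLattice c′ ℓ₁′ ℓ₂′ →
       BoundedDistributiveLattice (c ⊔ c′) (ℓ₁ ⊔ ℓ₁′) (ℓ₂ ⊔ ℓ₂′)
L ×ᴸ M = record
  { boundedLattice = record
    { Carrier = L.Carrier × M.Carrier
    ; _≈_ = Pointwise L._≈_ M._≈_
    ; _≤_ = Pointwise L._≤_ M._≤_
    ; _∨_ = λ (a , b) (a′ , b′) → (a L.∨ a′) , (b M.∨ b′)
    ; _∧_ = λ (a , b) (a′ , b′) → (a L.∧ a′) , (b M.∧ b′)
    ; ⊤ = L.⊤ , M.⊤
    ; ⊥ = L.⊥ , M.⊥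
    ; isBoundedLattice = record
      { isLattice = record
        { isPartialOrder = ×-isPartialOrder L.isPartialOrder M.isPartialOrder
        ; supremum = λ (a , b) (a′ , b′) →
            (L.x≤x∨y a a′ , M.x≤x∨y b b′) , (L.y≤x∨y a a′ , M.y≤x∨y b b′) ,
            λ _ (p , q) (r , s) → L.∨-least p r , M.∨-least q s
        ; infimum = λ (a , b) (a′ , b′) →
            (L.x∧y≤x a a′ , M.x∧y≤x b b′) , (L.x∧y≤y a a′ , M.x∧y≤y b b′) ,
            λ _ (p , q) (r , s) → L.∧-greatest p r , M.∧-greatest q s
        }
      ; maximum = λ (a , b) → L.maximum a , M.maximum b
      ; minimum = λ (a , b) → L.minimum a , M.minimum b
      }
    }
  ; ∧-distribˡ-∨ = λ (a , b) (a′ , b′) (a″ , b″) →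
      L.∧-distribˡ-∨ a a′ a″ , M.∧-distribˡ-∨ b b′ b″
  }
  where
  module L = BoundedDistributiveLattice L
  module M = BoundedDistributiveLattice M

module _ {c ℓ₁ ℓ₂ : Level} (L : BoundedDistributiveLattice c ℓ₁ ℓ₂) where
  open BoundedDistributiveLattice L

  record IsBoundedSublattice {p} (P : Pred Carrier p) : Set (c ⊔ p) where
    field
      ∨-closed : ∀ {a b} → a ∈ P → b ∈ P → (a ∨ b) ∈ P
      ∧-closed : ∀ {a b} → a ∈ P → b ∈ P → (a ∧ b) ∈ P
      ⊤-closed : ⊤ ∈ P
      ⊥-closed : ⊥ ∈ P

  Sublattice : ∀ {p} (P : Pred Carrier p) → IsBoundedSublattice P →
               BoundedDistributiveLattice (c ⊔ p) ℓ₁ ℓ₂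
  Sublattice P closed = record
    { boundedLattice = record
      { Carrier = ∃ P
      ; _≈_ = _≈_ on proj₁
      ; _≤_ = _≤_ on proj₁
      ; _∨_ = λ (a , p) (b , q) → (a ∨ b) , ∨-closed p q
      ; _∧_ = λ (a , p) (b , q) → (a ∧ b) , ∧-closed p q
      ; ⊤ = ⊤ , ⊤-closed
      ; ⊥ = ⊥ , ⊥-closed
      ; isBoundedLattice = record
        { isLattice = record
          { isPartialOrder = On.isPartialOrder proj₁ isPartialOrder
          ; supremum = λ (a , _) (b , _) →
              x≤x∨y a b , y≤x∨y a b , λ _ → ∨-least
          ; infimum = λ (a , _) (b , _) →
              x∧y≤x a b , x∧y≤y a b , λ _ → ∧-greatest
          }
        ; maximum = λ (a , _) → maximum a
        ; minimum = λ (a , _) → minimum a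
        }
      }
    ; ∧-distribˡ-∨ = λ (a , _) (b , _) (d , _) → ∧-distribˡ-∨ a b d
    }
    where open IsBoundedSublattice closed

module _ {c ℓ₁ ℓ₂ b p : Level} (X : OrderedSpace c ℓ₁ ℓ₂ b p) where
  open OrderedSpace X using
    (Carrier; Open; Clopen; Upset; size; covers; refine)
    renaming (refl to ≤-refl)

  ClopenUpset : Pred (Pred Carrier size) size
  ClopenUpset S = Clopen S × Upset S

  private
    open-∪ : {S T : Pred Carrier size} → Open S → Open T → Open (S ∪ T)
    open-∪ oS oT (inj₁ s) with B , u , f ← oS s = B , u , λ v → inj₁ (f v)
    open-∪ oS oT (inj₂ t) with B , u , f ← oT t = B , u , λ v → inj₂ (f v)

    open-∩ : {S T : Pred Carrier size} → Open S → Open T → Open (S ∩ T)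
    open-∩ oS oT (s , t)
      with B , u , f ← oS s | C , v , g ← oT t
      with D , w , h ← refine B C u v
      = D , w , λ r → f (proj₁ (h r)) , g (proj₂ (h r))

    open-resp : {S T : Pred Carrier size} → S ≐ T → Open S → Open T
    open-resp (S⊆T , T⊆S) oS t
      with B , u , f ← oS (T⊆S t) = B , u , λ v → S⊆T (f v)

    open-U : {S : Pred Carrier size} → (∀ u → u ∈ S) → Open S
    open-U all {u} _ with B , m ← covers u = B , m , λ {v} _ → all v

    ∁-∪ : (S T : Pred Carrier size) → (∁ S ∩ ∁ T) ≐ ∁ (S ∪ T)
    ∁-∪ S T = (λ (m , n) → [ m , n ]′) , λ n → n ∘ inj₁ , n ∘ inj₂

    ∁-∩ : (S T : Pred Carrier size) → Decidable S → (∁ S ∪ ∁ T) ≐ ∁ (S ∩ T)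
    ∁-∩ S T S? = [ (λ m → m ∘ proj₁) , (λ n → n ∘ proj₂) ]′ , λ {u} n → from u n
      where
      from : ∀ u → ¬ (S ∩ T) u → (∁ S ∪ ∁ T) u
      from u n with S? u
      ... | yes s = inj₂ λ t → n (s , t)
      ... | no ¬s = inj₁ ¬s

  clopenUpset-isBoundedSublattice :
    IsBoundedSublattice (Powerset Carrier size) ClopenUpset
  clopenUpset-isBoundedSublattice = record
    { ∨-closed = λ {S} {T} ((S? , oS , oS′) , uS , _) ((T? , oT , oT′) , uT , _) →
        ((λ u → S? u ⊎-dec T? u)
        , open-∪ {S} {T} oS oT
        , open-resp {∁ S ∩ ∁ T} {∁ (S ∪ T)} (∁-∪ S T) (open-∩ {∁ S} {∁ T} oS′ oT′))
        , (λ { (a , inj₁ s , a≤) → inj₁ (uS (a , s , a≤))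
             ; (a , inj₂ t , a≤) → inj₂ (uT (a , t , a≤)) })
        , λ m → _ , m , ≤-refl
    ; ∧-closed = λ {S} {T} ((S? , oS , oS′) , uS , _) ((T? , oT , oT′) , uT , _) →
        ((λ u → S? u ×-dec T? u)
        , open-∩ {S} {T} oS oT
        , open-resp {∁ S ∪ ∁ T} {∁ (S ∩ T)} (∁-∩ S T S?) (open-∪ {∁ S} {∁ T} oS′ oT′))
        , (λ (a , (s , t) , a≤) → uS (a , s , a≤) , uT (a , t , a≤))
        , λ m → _ , m , ≤-refl
    ; ⊤-closed =
        ((λ _ → yes _) , open-U {Poly.U} (λ _ → _) , λ n → ⊥-elim (n _))
        , (λ _ → _) , λ m → _ , m , ≤-refl
    ; ⊥-closed =
        ((λ _ → no λ ()) , (λ ()) , open-U {∁ Poly.∅} (λ _ ()))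
        , (λ ()) , λ ()
    }

  ClopenUpsets : BoundedDistributiveLattice (c ⊔ suc size) size size
  ClopenUpsets = Sublattice (Powerset Carrier size) ClopenUpset
                            clopenUpset-isBoundedSublattice

L₁ : BoundedDistributiveLattice (suc 0ℓ) 0ℓ 0ℓ
L₁ = ClopenUpsets (Z₁)

c₁ : BoundedDistributiveLattice.Carrier L₁
c₁ = ｛ y ｝
   , ( (λ { x → no λ () ; y → yes refl ; (z _) → no λ () })
     , (λ { refl → inj₁ y′ , refl , id })
     , (λ {u} y≢u → inj₂ (y′ ∷ []) , (λ { (here u≡y) → y≢u (sym u≡y) })
                  , λ v∉ y≡v → v∉ (here (sym y≡v))) )
   , (λ { (_ , refl , inj₁ ()) ; (_ , refl , inj₂ y≡u) → y≡u })
   , λ m → y , refl , inj₂ m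

-- It suffices to be contained in the set of entries of a list: by excluded
-- middle the list can be filtered so that it enumerates S exactly.
Finite : ∀ {a p} {A : Set a} → Pred A p → Set (a ⊔ p)
Finite S = ∃ λ ks → S ⊆ (List._∈ ks)

private
  ∪-finite : {S T : Pred ℕ 0ℓ} → Finite S → Finite T → Finite (S ∪ T)
  ∪-finite (ks , f) (ls , g) = ks ++ ls , [ ∈-++⁺ˡ ∘ f , ∈-++⁺ʳ ks ∘ g ]′

  ⊆-finite : {S T : Pred ℕ 0ℓ} → S ⊆ T → Finite T → Finite S
  ⊆-finite S⊆T (ks , f) = ks , f ∘ S⊆T

L₂ : BoundedDistributiveLattice (suc 0ℓ) (suc 0ℓ) (suc 0ℓ)
L₂ = record
  { boundedLattice = record
    { Carrier = Pfin ⁺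
    ; _≈_ = _≈∙_
    ; _≤_ = _≤⁺_
    ; _∨_ = _∨_
    ; _∧_ = _∧_
    ; ⊤ = ⊤⁺
    ; ⊥ = [ Poly.∅ , [] , (λ ()) ]
    ; isBoundedLattice = record
      { isLattice = record
        { isPartialOrder = ≤⁺-isPartialOrder (On.isPartialOrder proj₁ ⊆-isPartialOrder)
        ; supremum = supremum
        ; infimum = infimum
        }
      ; maximum = _≤⊤⁺
      ; minimum = λ { [ _ ] → [ (λ ()) ] ; ⊤⁺ → _ ≤⊤⁺ }
      }
    }
  ; ∧-distribˡ-∨ = distrib
  }
  where
  open import Relation.Binary.Lattice.Definitions using (Supremum; Infimum)

  Pfin : Set₁
  Pfin = ∃ λ (S : Pred ℕ 0ℓ) → Finite S

  open Order⁺ {A = Pfin} (_⊆_ on proj₁)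
  open Eq⁺ {A = Pfin} (_≐_ on proj₁)
    renaming (_≈⁺_ to _≈∙_; ⊤⁺≈⊤⁺ to ⊤≈⊤)

  _∨_ _∧_ : Pfin ⁺ → Pfin ⁺ → Pfin ⁺
  [ S , f ] ∨ [ T , g ] = [ S ∪ T , ∪-finite {S} {T} f g ]
  [ _ ]     ∨ ⊤⁺        = ⊤⁺
  ⊤⁺        ∨ _         = ⊤⁺

  [ S , f ] ∧ [ T , g ] = [ S ∩ T , ⊆-finite {S ∩ T} {S} proj₁ f ]
  [ S ]     ∧ ⊤⁺        = [ S ]
  ⊤⁺        ∧ u         = u

  ≤-refl⁺ : ∀ u → u ≤⁺ u
  ≤-refl⁺ [ _ ] = [ id ]
  ≤-refl⁺ ⊤⁺    = ⊤⁺ ≤⊤⁺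

  ≈-refl⁺ : ∀ u → u ≈∙ u
  ≈-refl⁺ [ _ ] = [ id , id ]
  ≈-refl⁺ ⊤⁺    = ⊤≈⊤

  supremum : Supremum _≤⁺_ _∨_
  supremum [ S ] [ T ] = [ inj₁ ] , [ inj₂ ] ,
    λ { _ [ f ] [ g ] → [ [ f , g ]′ ] ; _ (_ ≤⊤⁺) _ → _ ≤⊤⁺ }
  supremum [ S ] ⊤⁺ = (_ ≤⊤⁺) , (_ ≤⊤⁺) , λ _ _ q → q
  supremum ⊤⁺    u  = (_ ≤⊤⁺) , (_ ≤⊤⁺) , λ _ p _ → p

  infimum : Infimum _≤⁺_ _∧_
  infimum [ S ] [ T ] = [ proj₁ ] , [ proj₂ ] ,
    λ { _ [ f ] [ g ] → [ (λ r → f r , g r) ] }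
  infimum [ S ] ⊤⁺ = [ id ] , (_ ≤⊤⁺) , λ _ p _ → p
  infimum ⊤⁺    u  = (_ ≤⊤⁺) , ≤-refl⁺ u , λ _ _ q → q

  distrib : ∀ u v w → (u ∧ (v ∨ w)) ≈∙ ((u ∧ v) ∨ (u ∧ w))
  distrib [ _ ] [ _ ] [ _ ] = [ (λ (a , s) → Sum.map (a ,_) (a ,_) s) ,
    [ (λ (a , b) → a , inj₁ b) , (λ (a , d) → a , inj₂ d) ]′ ]
  distrib [ _ ] [ _ ] ⊤⁺    = [ inj₂ , [ proj₁ , id ]′ ]
  distrib [ _ ] ⊤⁺    [ _ ] = [ inj₁ , [ id , proj₁ ]′ ]
  distrib [ _ ] ⊤⁺    ⊤⁺    = [ inj₁ , [ id , id ]′ ]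
  distrib ⊤⁺    v     w     = ≈-refl⁺ (v ∨ w)

c₂ : BoundedDistributiveLattice.Carrier L₂
c₂ = [ ｛ 0 ｝ , 0 ∷ [] , (λ { refl → here refl }) ]

Cofinite : ∀ {a p} {A : Set a} → Pred A p → Set (a ⊔ p)
Cofinite S = Finite (∁ S)

private
  ∩-cofinite : {S T : Pred ℕ 0ℓ} → Cofinite S → Cofinite T → Cofinite (S ∩ T)
  ∩-cofinite {S} {T} (ks , f) (ls , g) = ks ++ ls , λ {n} → help n
    where
    help : ∀ n → ¬ (S ∩ T) n → n List.∈ (ks ++ ls)
    help n ¬st with ∈? ℕ._≟_ n ks | ∈? ℕ._≟_ n ls
    ... | yes p | _     = ∈-++⁺ˡ p
    ... | no _  | yes q = ∈-++⁺ʳ ks q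
    ... | no ¬p | no ¬q = contradiction (f λ s → ¬q (g λ t → ¬st (s , t))) ¬p

  ∪-cofinite : {S T : Pred ℕ 0ℓ} → Cofinite S ⊎ Cofinite T → Cofinite (S ∪ T)
  ∪-cofinite {S} {T} (inj₁ f) = ⊆-finite {∁ (S ∪ T)} {∁ S} (_∘ inj₁) f
  ∪-cofinite {S} {T} (inj₂ g) = ⊆-finite {∁ (S ∪ T)} {∁ T} (_∘ inj₂) g

CF-isBoundedSublattice :
  IsBoundedSublattice (Powerset ℕ 0ℓ) (λ S → Finite S ⊎ Cofinite S)
CF-isBoundedSublattice = record
  { ∨-closed = λ
    { {S} {T} (inj₁ f) (inj₁ g) → inj₁ (∪-finite {S} {T} f g)
    ; {S} {T} (inj₁ _) (inj₂ g) → inj₂ (∪-cofinite {S} {T} (inj₂ g))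
    ; {S} {T} (inj₂ f) _        → inj₂ (∪-cofinite {S} {T} (inj₁ f)) }
  ; ∧-closed = λ
    { {S} {T} (inj₁ f) _        → inj₁ (⊆-finite {S ∩ T} {S} proj₁ f)
    ; {S} {T} (inj₂ _) (inj₁ g) → inj₁ (⊆-finite {S ∩ T} {T} proj₂ g)
    ; {S} {T} (inj₂ f) (inj₂ g) → inj₂ (∩-cofinite {S} {T} f g) }
  ; ⊤-closed = inj₂ ([] , λ n → ⊥-elim (n _))
  ; ⊥-closed = inj₁ ([] , λ ())
  }

CF : BoundedDistributiveLattice (suc 0ℓ) 0ℓ 0ℓ
CF = Sublattice (Powerset ℕ 0ℓ) (λ S → Finite S ⊎ Cofinite S) CF-isBoundedSublattice

InL₃ : Pred (BoundedDistributiveLattice.Carrier (CF ×ᴸ 𝟚)) 0ℓ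
InL₃ ((S , _) , n) = Finite S ⊎ (n ≡ true)

InL₃-isBoundedSublattice : IsBoundedSublattice (CF ×ᴸ 𝟚) InL₃
InL₃-isBoundedSublattice = record
  { ∨-closed = λ
    { {(S , _) , _} {(T , _) , _} (inj₁ f) (inj₁ g) → inj₁ (∪-finite {S} {T} f g)
    ; {_ , m} (inj₁ _) (inj₂ refl) → inj₂ (Bool.∨-zeroʳ m)
    ; (inj₂ refl) _ → inj₂ refl }
  ; ∧-closed = λ
    { {(S , _) , _} {(T , _) , _} (inj₁ f) _ → inj₁ (⊆-finite {S ∩ T} {S} proj₁ f)
    ; {(S , _) , _} {(T , _) , _} (inj₂ _) (inj₁ g) → inj₁ (⊆-finite {S ∩ T} {T} proj₂ g)
    ; (inj₂ refl) (inj₂ refl) → inj₂ refl }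
  ; ⊤-closed = inj₂ refl
  ; ⊥-closed = inj₁ ([] , λ ())
  }

L₃ : BoundedDistributiveLattice (suc 0ℓ) 0ℓ 0ℓ
L₃ = Sublattice (CF ×ᴸ 𝟚) InL₃ InL₃-isBoundedSublattice

c₃ : BoundedDistributiveLattice.Carrier L₃
c₃ = ((Poly.∅ , inj₁ ([] , λ ())) , true) , inj₂ refl

{-# OPTIONS --safe #-}

-- Let a ∈ L.  The points outside ↓ (α a) form the open set W = ⋃ {α d ∣ d ∧ a ≤ ⊥},
-- which is compact exactly when a has a pseudocomplement.  If it has none, some
-- x ∈ ↓ (α a) is the limit of a sequence zₙ in W, and x < y for some y ∈ α a.
-- After passing to a subsequence the zₙ form a descending chain above x, or an
-- antichain lying entirely above x or entirely not above x.  So {x, y} ∪ {zₙ}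
-- is a copy of Z₁, Z₂ or Z₃, and restricting clopen upsets of X to it is the
-- required quotient of L.

module Submission where

open import Defs
open import Algebra.Lattice.Morphism.Structures using (module LatticeMorphisms)
open import Axiom.ExcludedMiddle using (ExcludedMiddle)
open import Data.Bool.Base as Bool using (true; false)
open import Data.Empty as Empty using (⊥-elim)
open import Data.List.Base using (List; []; _∷_; _++_; map; upTo)
import Data.List.Membership.Propositional as List
open import Data.List.Membership.Propositional.Properties using (∈-map⁺; ∈-map⁻; ∈-upTo⁺)
open import Data.List.Relation.Unary.Any using (Any; here; there)
import Data.List.Relation.Unary.Any.Properties as Any
open import Data.Maybe.Base using (just; nothing)
open import Data.Nat.Base as ℕ using (ℕ; zero; suc)
import Data.Nat.Properties as ℕ
open import Data.Product.Base using (Σ-syntax; ∃; _×_; _,_; proj₁; proj₂)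
open import Data.Sum.Base as Sum using (_⊎_; inj₁; inj₂; [_,_]′)
import Data.Unit.Base as Unit
open import Function.Base using (_∘_; id; case_of_; _$_)
open import Function.Bundles using (_⇔_; Injection; mk⇔)
open import Function.Definitions using (Injective)
open import Level using (Level; _⊔_; Lift; lift; lower; 0ℓ)
import Relation.Binary.Construct.Add.Supremum.NonStrict as Order⁺
open import Relation.Binary.Core using (Rel)
open import Relation.Binary.Definitions using (Transitive)
open import Relation.Binary.PropositionalEquality as ≡ using (_≡_; refl)
open import Relation.Binary.Structures using (IsStrictPartialOrder)
open import Relation.Nullary using (¬_; Dec; yes; no; does)
open import Relation.Nullary.Construct.Add.Supremum using (⊤⁺; [_])
open import Relation.Nullary.Decidable
  using (True; toWitness; fromWitness; dec-true; dec-false; decidable-stable)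
open import Relation.Unary using (Pred; _∈_; _∉_; _⊆_; _≐_; _∩_; ∁; ｛_｝)

-- Excluded middle is the only classical principle assumed, so points of the Priestley space do not
-- come from Zorn's lemma. Countability takes its place: `large-point` runs through `L` by codes and
-- produces a prime filter none of whose basic neighbourhoods belongs to a given ideal of clopen
-- sets. Varying the ideal gives the prime filter theorem, extensions of prime filters, compactness
-- and the limit point. The same construction leaves a countable neighbourhood base of the point it
-- finds, which is why a sequence suffices to approach it. The points of that sequence carry
-- witnesses from `I[ a ⟶ ⊥ ]`, each excluded from all later points. The witnesses keep the points
-- apart, leave only descending pairs to be sorted out, and reappear as the elements that make the
-- image of `I[ a ⟶ ⊥ ]` large enough. Conversely, a pseudocomplement in `L` would be sent to a
-- greatest element of the corresponding ideal of the quotient, and there is none. Reading each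
-- quotient as a lattice of clopen upsets of `Point` lets one argument serve all three cases.

module Classical (em : ∀ {ℓ} → ExcludedMiddle ℓ) where

  dne : ∀ {p} {P : Set p} → ¬ ¬ P → P
  dne = decidable-stable em

  ¬∀⟶∃¬ : ∀ {a p} {A : Set a} {P : Pred A p} → ¬ (∀ u → u ∈ P) → ∃ λ u → u ∉ P
  ¬∀⟶∃¬ ¬∀ = dne λ ¬∃ → ¬∀ λ u → dne λ u∉P → ¬∃ (u , u∉P)

  ⊈⇒∃ : ∀ {a p q} {A : Set a} {P : Pred A p} {Q : Pred A q} →
        ¬ (P ⊆ Q) → ∃ λ u → (u ∈ P) × (u ∉ Q)
  ⊈⇒∃ P⊈Q = dne λ ¬∃ → P⊈Q λ {u} u∈P → dne λ u∉Q → ¬∃ (u , u∈P , u∉Q)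

-- Distributivity and ideals of clopen sets

module _ {c ℓ₁ ℓ₂ : Level} (L : BoundedDistributiveLattice c ℓ₁ ℓ₂) where
  open BoundedDistributiveLattice L renaming (refl to ≤-refl; trans to ≤-trans)

  -- Distributivity splits `f` into its meets with `j` and with `a`. For clopen sets: α f minus α j
  -- is empty once its parts inside and outside α a are. This yields `glue` for the ideals below
  -- that are defined by inequalities.
  cut : ∀ {f j a} → (f ∧ a) ≤ j → f ≤ (j ∨ a) → f ≤ j
  cut {f} {j} {a} f∧a≤j f≤j∨a = ≤-trans
    (∧-greatest ≤-refl f≤j∨a)
    (≤-trans (reflexive (∧-distribˡ-∨ f j a)) (∨-least (x∧y≤y f j) f∧a≤j))

  I-∨-closed : ∀ {a b d e} → d ∈ I[_⟶_] L a b → e ∈ I[_⟶_] L a b → (d ∨ e) ∈ I[_⟶_] L a b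
  I-∨-closed {a} {d = d} {e} d∈I e∈I = ≤-trans (∧-greatest (x∧y≤y _ a) (x∧y≤x _ a))
    (≤-trans (reflexive (∧-distribˡ-∨ a d e))
      (∨-least (≤-trans (∧-greatest (x∧y≤y a d) (x∧y≤x a d)) d∈I)
               (≤-trans (∧-greatest (x∧y≤y a e) (x∧y≤x a e)) e∈I)))

  -- Small f j says that the clopen set α f ∖ α j belongs to some ideal of
  -- clopen sets.
  record IsClopenIdeal {p} (Small : Carrier → Carrier → Set p) : Set (c ⊔ ℓ₂ ⊔ p) where
    field
      empty : ∀ {f j} → f ≤ j → Small f j
      shrink : ∀ {f f′ j j′} → f′ ≤ f → j ≤ j′ → Small f j → Small f′ j′
      glue : ∀ {f j} a → Small (f ∧ a) j → Small f (j ∨ a) → Small f j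

  -- `base` keeps the shrinking clopen sets that produced the point. They are a countable
  -- neighbourhood base, from which a convergent sequence is built later.
  record LargePoint {p} (Small : Carrier → Carrier → Set p) (f j : Carrier)
         : Set (Level.suc (c ⊔ ℓ₁ ⊔ ℓ₂) ⊔ p) where
    field
      filter : PrimeFilter L
    open PrimeFilter filter public
    field
      f∈ : f ∈ Member
      j∉ : j ∉ Member
      large : ∀ {a b} → a ∈ Member → b ∉ Member → ¬ Small a b
      base : ℕ → Carrier × Carrier
      base∋ : ∀ n → (proj₁ (base n) ∈ Member) × (proj₂ (base n) ∉ Member)
      base-decreasing : ∀ {m n} → m ℕ.≤ n →
        (proj₁ (base n) ≤ proj₁ (base m)) × (proj₂ (base m) ≤ proj₂ (base n))
      base-generates : ∀ {a b} → a ∈ Member → b ∉ Member →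
        ∃ λ n → (proj₁ (base n) ≤ a) × (b ≤ proj₂ (base n))

-- Prime filters of a countable lattice and its Priestley space

module PrimeFilters (em : ∀ {ℓ} → ExcludedMiddle ℓ) {c ℓ₁ ℓ₂ : Level}
                    (L : BoundedDistributiveLattice c ℓ₁ ℓ₂)
                    (countable : Countable (BoundedDistributiveLattice.setoid L)) where
  open Classical em
  open BoundedDistributiveLattice L renaming (refl to ≤-refl; trans to ≤-trans)
  open Injection countable using () renaming (to to code; injective to code-injective)
  open PrimeFilter

  -- Halve a large clopen set by each element of the lattice in turn, always
  -- keeping a large half; the sets kept converge to a point.
  module _ {p} {Small : Carrier → Carrier → Set p} (ideal : IsClopenIdeal L Small)
           {f j : Carrier} (f∖j-large : ¬ Small f j) where
    open IsClopenIdeal ideal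

    private
      Large : Set (c ⊔ p)
      Large = Σ[ (a , b) ∈ Carrier × Carrier ] ¬ Small a b

      fst snd : Large → Carrier
      fst = proj₁ ∘ proj₁
      snd = proj₂ ∘ proj₁

      halve : Carrier → Large → Large
      halve d ((a , b) , l) with em {P = Small (a ∧ d) b}
      ... | yes s = (a , b ∨ d) , l ∘ glue d s
      ... | no ¬s = (a ∧ d , b) , ¬s

      halve-decides : ∀ d u → fst (halve d u) ≤ d ⊎ d ≤ snd (halve d u)
      halve-decides d ((a , b) , _) with em {P = Small (a ∧ d) b}
      ... | yes _ = inj₂ (y≤x∨y b d)
      ... | no _  = inj₁ (x∧y≤y a d)

      halve-decreasing : ∀ d u → fst (halve d u) ≤ fst u × snd u ≤ snd (halve d u)
      halve-decreasing d ((a , b) , _) with em {P = Small (a ∧ d) b}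
      ... | yes _ = ≤-refl , x≤x∨y b d
      ... | no _  = x∧y≤x a d , ≤-refl

      step : ℕ → Large → Large
      step n u with em {P = ∃ λ d → code d ≡ n}
      ... | yes (d , _) = halve d u
      ... | no _        = u

      step-decides : ∀ d u → fst (step (code d) u) ≤ d ⊎ d ≤ snd (step (code d) u)
      step-decides d u with em {P = ∃ λ e → code e ≡ code d}
      ... | yes (e , e≡d) = Sum.map (λ le → ≤-trans le (reflexive e≈d))
                                    (≤-trans (reflexive (Eq.sym e≈d))) (halve-decides e u)
        where e≈d = code-injective e≡d
      ... | no ¬e = ⊥-elim (¬e (d , refl))

      step-decreasing : ∀ n u → fst (step n u) ≤ fst u × snd u ≤ snd (step n u)
      step-decreasing n u with em {P = ∃ λ d → code d ≡ n}
      ... | yes (d , _) = halve-decreasing d u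
      ... | no _        = ≤-refl , ≤-refl

      stage : ℕ → Large
      stage zero    = (f , j) , f∖j-large
      stage (suc n) = step n (stage n)

      A B : ℕ → Carrier
      A = fst ∘ stage
      B = snd ∘ stage

      decreasing′ : ∀ {m n} → m ℕ.≤′ n → A n ≤ A m × B m ≤ B n
      decreasing′ ℕ.≤′-refl = ≤-refl , ≤-refl
      decreasing′ {n = suc n} (ℕ.≤′-step m≤n) =
        ≤-trans (proj₁ (step-decreasing n (stage n))) (proj₁ (decreasing′ m≤n)) ,
        ≤-trans (proj₂ (decreasing′ m≤n)) (proj₂ (step-decreasing n (stage n)))

      decreasing : ∀ {m n} → m ℕ.≤ n → A n ≤ A m × B m ≤ B n
      decreasing = decreasing′ ∘ ℕ.≤⇒≤′

      A≰B : ∀ m n → ¬ A m ≤ B n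
      A≰B m n Am≤Bn = proj₂ (stage (m ℕ.⊔ n)) $ empty $
        ≤-trans (proj₁ (decreasing (ℕ.m≤m⊔n m n)))
                (≤-trans Am≤Bn (proj₂ (decreasing (ℕ.m≤n⊔m m n))))

      decided : ∀ d → (∃ λ n → A n ≤ d) ⊎ (∃ λ n → d ≤ B n)
      decided d = Sum.map (suc (code d) ,_) (suc (code d) ,_) (step-decides d (stage (code d)))

      below : ∀ {d} → ¬ Lift (c ⊔ ℓ₁) (∃ λ n → A n ≤ d) → ∃ λ n → d ≤ B n
      below {d} n≰ = [ ⊥-elim ∘ n≰ ∘ lift , id ]′ (decided d)

      -- The filter generated by the `A n`. Its complement is the ideal generated by the `B n`:
      -- `decided` puts each element into one of the two, and `A≰B` keeps them disjoint. Hence it is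
      -- prime.
      F : PrimeFilter L
      F = record
        { Member   = λ d → Lift (c ⊔ ℓ₁) (∃ λ n → A n ≤ d)
        ; ⊤-member = lift (0 , maximum _)
        ; upward   = λ a≤b (lift (n , le)) → lift (n , ≤-trans le a≤b)
        ; ∧-closed = λ (lift (m , p)) (lift (n , q)) → lift (m ℕ.⊔ n ,
            ∧-greatest (≤-trans (proj₁ (decreasing (ℕ.m≤m⊔n m n))) p)
                       (≤-trans (proj₁ (decreasing (ℕ.m≤n⊔m m n))) q))
        ; proper   = λ (lift (n , le)) → A≰B n 0 (≤-trans le (minimum _))
        ; prime    = λ {a} {b} (lift (m , le)) → prime′ m le (decided a) (decided b)
        }
        where
        prime′ : ∀ {a b} m → A m ≤ (a ∨ b) →
                 (∃ λ n → A n ≤ a) ⊎ (∃ λ n → a ≤ B n) →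
                 (∃ λ n → A n ≤ b) ⊎ (∃ λ n → b ≤ B n) →
                 Lift (c ⊔ ℓ₁) (∃ λ n → A n ≤ a) ⊎ Lift (c ⊔ ℓ₁) (∃ λ n → A n ≤ b)
        prime′ m le (inj₁ p) _ = inj₁ (lift p)
        prime′ m le (inj₂ _) (inj₁ q) = inj₂ (lift q)
        prime′ m le (inj₂ (k , p)) (inj₂ (l , q)) = ⊥-elim $ A≰B m (k ℕ.⊔ l) $
          ≤-trans le (∨-least (≤-trans p (proj₂ (decreasing (ℕ.m≤m⊔n k l))))
                              (≤-trans q (proj₂ (decreasing (ℕ.m≤n⊔m k l)))))

    large-point : LargePoint L Small f j
    large-point = record
      { filter = F
      ; f∈ = lift (0 , ≤-refl)
      ; j∉ = λ (lift (n , le)) → A≰B n 0 le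
      ; large = λ (lift (m , Am≤a)) b∉F a∖b-small →
          let n , b≤Bn = below b∉F in
          proj₂ (stage (m ℕ.⊔ n)) $ shrink
            (≤-trans (proj₁ (decreasing (ℕ.m≤m⊔n m n))) Am≤a)
            (≤-trans b≤Bn (proj₂ (decreasing (ℕ.m≤n⊔m m n)))) a∖b-small
      ; base = proj₁ ∘ stage
      ; base∋ = λ n → lift (n , ≤-refl) , λ (lift (m , le)) → A≰B m n le
      ; base-decreasing = decreasing
      ; base-generates = λ (lift (m , Am≤a)) b∉F →
          let n , b≤Bn = below b∉F in
          m ℕ.⊔ n , ≤-trans (proj₁ (decreasing (ℕ.m≤m⊔n m n))) Am≤a
                  , ≤-trans b≤Bn (proj₂ (decreasing (ℕ.m≤n⊔m m n)))
      }

  -- Here the ideal is the least one, that of the empty clopen sets.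
  ≰-separated : ∀ {f j} → ¬ f ≤ j → ∃ λ (F : PrimeFilter L) → (f ∈ Member F) × (j ∉ Member F)
  ≰-separated f≰j = filter , f∈ , j∉
    where
    ideal : IsClopenIdeal L _≤_
    ideal = record
      { empty  = id
      ; shrink = λ f′≤f j≤j′ f≤j → ≤-trans f′≤f (≤-trans f≤j j≤j′)
      ; glue   = λ _ → cut L
      }

    open LargePoint (large-point {Small = _≤_} ideal f≰j)

  -- A clopen set is small when it misses α b for some b ∈ F; consistency says that α a is large.
  -- Since α a minus α b is small for b ∈ F, a large point in α a must contain all of F.
  extension : ∀ (F : PrimeFilter L) {a} → (∀ {b} → b ∈ Member F → ¬ (b ∧ a) ≤ ⊥) →
              ∃ λ (G : PrimeFilter L) → (Member F ⊆ Member G) × (a ∈ Member G)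
  extension F {a} consistent = filter , F⊆ , f∈
    where
    Small : Carrier → Carrier → Set (c ⊔ ℓ₁ ⊔ ℓ₂)
    Small f j = ∃ λ b → (b ∈ Member F) × ((b ∧ f) ≤ j)

    ideal : IsClopenIdeal L Small
    ideal = record
      { empty  = λ {f} f≤j → ⊤ , ⊤-member F , ≤-trans (x∧y≤y ⊤ f) f≤j
      ; shrink = λ {f} {f′} f′≤f j≤j′ (b , b∈F , le) → b , b∈F ,
          ≤-trans (∧-greatest (x∧y≤x b f′) (≤-trans (x∧y≤y b f′) f′≤f)) (≤-trans le j≤j′)
      ; glue   = λ {f} {j} a (b , b∈F , p) (d , d∈F , q) →
          b ∧ d , ∧-closed F b∈F d∈F , cut L
            (≤-trans (∧-greatest
              (≤-trans (x∧y≤x _ a) (≤-trans (x∧y≤x _ f) (x∧y≤x b d)))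
              (∧-greatest (≤-trans (x∧y≤x _ a) (x∧y≤y _ f)) (x∧y≤y _ a))) p)
            (≤-trans (∧-greatest (≤-trans (x∧y≤x _ f) (x∧y≤y b d)) (x∧y≤y _ f)) q)
      }

    open LargePoint (large-point {Small = Small} ideal {a} {⊥} λ (b , b∈F , le) → consistent b∈F le)
      using (filter; f∈; large)

    F⊆ : Member F ⊆ Member filter
    F⊆ {b} b∈F = dne λ b∉ → large f∈ b∉ (b , b∈F , x∧y≤x b a)

  private
    X = PriestleySpace L
    module X = OrderedSpace X

  ∁α-open : ∀ a → X.Open (∁ (α L a))
  ∁α-open a {F} a∉F = (⊤ , a) , (⊤-member F , a∉F) , proj₂

  α-open : ∀ a → X.Open (α L a)
  α-open a {F} a∈F = (a , ⊥) , (a∈F , proper F) , proj₁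

  -- The ideal consists of the clopen sets covered by finitely many `S i`. A large point would lie
  -- in some `S i` together with a basic neighbourhood, which a single set then covers.
  compact : X.Compact
  compact {I} S S-open S-covers = dne λ ¬finite →
    let open LargePoint (large-point ideal {⊤} {⊥} λ (is , covered) →
               ¬finite (is , λ F → covered F (⊤-member F) (proper F)))
        i , F∈S = S-covers filter
        (a , b) , (a∈F , b∉F) , ⊆S = S-open i F∈S
    in large a∈F b∉F (i ∷ [] , λ G a∈G b∉G → here (⊆S (a∈G , b∉G)))
    where
    Small : Carrier → Carrier → Set _
    Small f j = ∃ λ (is : List I) → ∀ (F : PrimeFilter L) → f ∈ Member F → j ∉ Member F →
                Any (λ i → F ∈ S i) is

    ideal : IsClopenIdeal L Small
    ideal = record
      { empty  = λ f≤j → [] , λ F f∈F j∉F → ⊥-elim (j∉F (upward F f≤j f∈F))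
      ; shrink = λ f′≤f j≤j′ (is , covered) → is , λ F f′∈F j′∉F →
          covered F (upward F f′≤f f′∈F) (j′∉F ∘ upward F j≤j′)
      ; glue   = λ {f} {j} a (is , p) (ks , q) → is ++ ks , λ F f∈F j∉F →
          case-split F is ks (λ a∈F → p F (∧-closed F f∈F a∈F) j∉F)
                             (λ a∉F → q F f∈F ([ j∉F , a∉F ]′ ∘ prime F))
      }
      where
      case-split : ∀ F is ks {a} → (a ∈ Member F → Any (λ i → F ∈ S i) is) →
                   (a ∉ Member F → Any (λ i → F ∈ S i) ks) → Any (λ i → F ∈ S i) (is ++ ks)
      case-split F is ks {a} p q with em {P = a ∈ Member F}
      ... | yes a∈F = Any.++⁺ˡ (p a∈F)
      ... | no a∉F  = Any.++⁺ʳ is (q a∉F)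

  α-clopenUpset : ∀ a → X.Clopen (λ F → Lift X.size (a ∈ Member F)) ×
                        X.Upset (λ F → Lift X.size (a ∈ Member F))
  α-clopenUpset a =
    ( (λ F → em)
    , (λ {F} (lift a∈F) → let B , F∈B , B⊆ = α-open a {F} a∈F in
        B , F∈B , λ {G} G∈B → lift (B⊆ {G} G∈B))
    , λ {F} a∉F → let B , F∈B , B⊆ = ∁α-open a {F} (a∉F ∘ lift) in
        B , F∈B , λ {G} G∈B → B⊆ {G} G∈B ∘ lower )
    , (λ (F , lift a∈F , F⊆G) → lift (F⊆G a∈F))
    , λ {F} a∈F → F , a∈F , id

  isPriestleySpace : X.IsPriestleySpace
  isPriestleySpace = compact , λ F⊈G →
    let a , a∈F , a∉G = ⊈⇒∃ F⊈G
        clopen , upset = α-clopenUpset a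
    in _ , clopen , upset , lift a∈F , a∉G ∘ lower

  -- The clopen sets α f ∖ α j for which some α (f ∧ b) ∖ α j with b ∈ G lies
  -- in S form an ideal; a large point would be above G but outside S.
  open-upset-nbhd : ∀ {q} {S : Pred (PrimeFilter L) q} → X.Open S → X.Upset S → ∀ G → G ∈ S →
                    ∃ λ b → (b ∈ Member G) × (α L b ⊆ S)
  open-upset-nbhd {S = S} S-open (↑S⊆S , _) G G∈S = dne λ ¬nbhd →
    let open LargePoint (large-point ideal {⊤} {⊥} λ (b , b∈G , ⊆S) →
               ¬nbhd (b , b∈G , λ {F} b∈F → ⊆S F (⊤-member F) b∈F (proper F)))
        G⊆F = λ {b} (b∈G : b ∈ Member G) → dne λ b∉F →
                large f∈ b∉F (b , b∈G , λ _ _ b∈H b∉H → ⊥-elim (b∉H b∈H))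
        (a , b) , (a∈F , b∉F) , ⊆S = S-open (↑S⊆S {filter} (G , G∈S , G⊆F))
    in large a∈F b∉F (⊤ , ⊤-member G , λ _ a∈H _ b∉H → ⊆S (a∈H , b∉H))
    where
    Small : Carrier → Carrier → Set _
    Small f j = ∃ λ b → (b ∈ Member G) ×
      (∀ (F : PrimeFilter L) → f ∈ Member F → b ∈ Member F → j ∉ Member F → F ∈ S)

    ideal : IsClopenIdeal L Small
    ideal = record
      { empty  = λ f≤j → ⊤ , ⊤-member G , λ F f∈F _ j∉F → ⊥-elim (j∉F (upward F f≤j f∈F))
      ; shrink = λ f′≤f j≤j′ (b , b∈G , ⊆S) → b , b∈G , λ F f′∈F b∈F j′∉F →
          ⊆S F (upward F f′≤f f′∈F) b∈F (j′∉F ∘ upward F j≤j′)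
      ; glue   = λ a (b , b∈G , p) (d , d∈G , q) → b ∧ d , ∧-closed G b∈G d∈G ,
          λ F f∈F b∧d∈F j∉F → case-split F
            (λ a∈F → p F (∧-closed F f∈F a∈F) (upward F (x∧y≤x b d) b∧d∈F) j∉F)
            (λ a∉F → q F f∈F (upward F (x∧y≤y b d) b∧d∈F) ([ j∉F , a∉F ]′ ∘ prime F))
      }
      where
      case-split : ∀ F {a} → (a ∈ Member F → F ∈ S) → (a ∉ Member F → F ∈ S) → F ∈ S
      case-split F {a} p q with em {P = a ∈ Member F}
      ... | yes a∈F = p a∈F
      ... | no a∉F  = q a∉F

  -- If d is the pseudocomplement of b, then ↓ (α b) is the complement of α d and so is open. By
  -- `open-upset-nbhd` an open upset is a union of sets α b.
  isPSpace : IsPAlgebra L → X.IsPSpace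
  isPSpace pAlgebra = isPriestleySpace , ↓-open
    where
    ↓-open : ∀ (S : Pred X.Carrier X.size) → X.Open S → X.Upset S → X.Open (X.↓ S)
    ↓-open S S-open S-upset {F} (G , G∈S , F⊆G) =
      (⊤ , d) , (⊤-member F , d∉F) , λ {H} (_ , d∉H) →
        let K , H⊆K , b∈K = extension H λ {e} e∈H e∧b≤⊥ →
              d∉H (upward H (d-greatest e (antisym e∧b≤⊥ (minimum _))) e∈H)
        in K , ⊆S {K} b∈K , H⊆K
      where
      nbhd = open-upset-nbhd S-open S-upset G G∈S
      b = proj₁ nbhd
      ⊆S = proj₂ (proj₂ nbhd)
      d = proj₁ (pAlgebra b)
      d-greatest = proj₂ (proj₂ (pAlgebra b))
      d∉F : d ∉ Member F
      d∉F d∈F = proper G (upward G (reflexive (proj₁ (proj₂ (pAlgebra b))))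
        (∧-closed G (F⊆G d∈F) (proj₁ (proj₂ nbhd))))

-- Sequences and subsequences

Eventually : ∀ {p} → Pred ℕ p → Set p
Eventually P = ∃ λ N → ∀ n → N ℕ.≤ n → P n

eventually-× : ∀ {p q} {P : Pred ℕ p} {Q : Pred ℕ q} →
               Eventually P → Eventually Q → Eventually λ n → P n × Q n
eventually-× (M , p) (N , q) = M ℕ.⊔ N , λ n le →
  p n (ℕ.≤-trans (ℕ.m≤m⊔n M N) le) , q n (ℕ.≤-trans (ℕ.m≤n⊔m M N) le)

eventually-map : ∀ {p q} {P : Pred ℕ p} {Q : Pred ℕ q} →
                 (∀ {n} → P n → Q n) → Eventually P → Eventually Q
eventually-map f (N , p) = N , λ n le → f (p n le)

eventually-some : ∀ {p} {P : Pred ℕ p} → Eventually P → ∃ P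
eventually-some (N , p) = N , p N ℕ.≤-refl

iterate : ∀ {q r} {Q : Pred ℕ q} {R : Rel ℕ r} → Transitive R →
          (∀ {i} → i ∈ Q → ∃ λ j → (j ∈ Q) × R i j) → ∃ Q →
          ∃ λ (s : ℕ → ℕ) → (∀ n → s n ∈ Q) × (∀ {m n} → m ℕ.< n → R (s m) (s n))
iterate {Q = Q} {R} R-trans next start =
  proj₁ ∘ orbit , proj₂ ∘ orbit , λ m<n → related (ℕ.≤⇒≤′ m<n)
  where
  orbit : ℕ → ∃ Q
  orbit zero    = start
  orbit (suc n) = let j , j∈Q , _ = next (proj₂ (orbit n)) in j , j∈Q

  step : ∀ n → R (proj₁ (orbit n)) (proj₁ (orbit (suc n)))
  step n = proj₂ (proj₂ (next (proj₂ (orbit n))))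

  related : ∀ {m n} → suc m ℕ.≤′ n → R (proj₁ (orbit m)) (proj₁ (orbit n))
  related {m} ℕ.≤′-refl = step m
  related {n = suc n} (ℕ.≤′-step m<n) = R-trans (related m<n) (step n)

increasing⇒inflationary : ∀ {s : ℕ → ℕ} → (∀ {m n} → m ℕ.< n → s m ℕ.< s n) → ∀ n → n ℕ.≤ s n
increasing⇒inflationary s-mono zero    = ℕ.z≤n
increasing⇒inflationary s-mono (suc n) =
  ℕ.≤-<-trans (increasing⇒inflationary s-mono n) (s-mono ℕ.≤-refl)

Frequently : ∀ {p} → Pred ℕ p → Set p
Frequently P = ∀ N → ∃ λ n → (N ℕ.≤ n) × P n

frequently-∩ : ∀ {p q} {P : Pred ℕ p} {Q : Pred ℕ q} →
               Frequently P → Eventually Q → Frequently (P ∩ Q)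
frequently-∩ often (M , Q-holds) N =
  let n , le , Pn = often (M ℕ.⊔ N) in
  n , ℕ.≤-trans (ℕ.m≤n⊔m M N) le , Pn , Q-holds n (ℕ.≤-trans (ℕ.m≤m⊔n M N) le)

frequently⇒subsequence : ∀ {p} {P : Pred ℕ p} → Frequently P →
  ∃ λ (s : ℕ → ℕ) → (∀ n → s n ∈ P) × (∀ {m n} → m ℕ.< n → s m ℕ.< s n)
frequently⇒subsequence {P = P} often = iterate {Q = P} ℕ.<-trans
  (λ {i} _ → let j , i<j , Pj = often (suc i) in j , Pj , i<j)
  (let i , _ , Pi = often 0 in i , Pi)

-- Compactness of the space of points, for a cover by sets R a directed by ⊕.
points-compact : ∀ {a r} {A : Set a} {R : A → Pred Point r} (_⊕_ : A → A → A) →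
                 (∀ {a b} u → u ∈ R a → u ∈ R (a ⊕ b)) → (∀ {a b} u → u ∈ R b → u ∈ R (a ⊕ b)) →
                 (∀ {a} → x ∈ R a → Eventually λ n → z n ∈ R a) →
                 (∀ u → ∃ λ a → u ∈ R a) → ∃ λ a → ∀ u → u ∈ R a
points-compact {A = A} {R} _⊕_ left right near-x covers =
  (aₓ ⊕ (a-y ⊕ proj₁ initial)) , λ where
    x → left x x∈aₓ
    y → right y (left y y∈a)
    (z n) → [ (λ N≤n → left (z n) (tail n N≤n))
            , (λ n<N → right (z n) (right (z n) (proj₂ initial n n<N))) ]′ (ℕ.≤-<-connex N n)
  where
  aₓ = proj₁ (covers x)
  x∈aₓ = proj₂ (covers x)
  a-y = proj₁ (covers y)
  y∈a = proj₂ (covers y)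
  N = proj₁ (near-x x∈aₓ)
  tail = proj₂ (near-x x∈aₓ)

  first : ∀ N → ∃ λ a → ∀ n → n ℕ.< N → z n ∈ R a
  first zero    = aₓ , λ _ ()
  first (suc N) =
    let a , a∋ = first N
        b , b∋ = covers (z N)
    in (a ⊕ b) , λ n n<1+N →
      [ left (z n) ∘ a∋ n , (λ { refl → right (z N) b∋ }) ]′ (ℕ.m<1+n⇒m<n∨m≡n n<1+N)

  initial = first N

-- Clopen upsets of the three model spaces

record IsClopenUpset {t} (_<_ : Rel Point 0ℓ) (T : Pred Point t) : Set t where
  field
    upset  : ∀ {u v} → u < v → u ∈ T → v ∈ T
    -- Only `x` is not isolated, so openness of `T` and of its complement are conditions at `x`,
    -- namely on the tail of the `z n`.
    near-x : x ∈ T → Eventually λ n → z n ∈ T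
    away-x : x ∉ T → Eventually λ n → z n ∉ T

-- What the proof uses of the orders of Z₁, Z₂ and Z₃ uniformly.
record IsShape (_<_ : Rel Point 0ℓ) : Set where
  field
    isStrictPartialOrder : IsStrictPartialOrder _≡_ _<_
    x-below-y : x < y
    y-maximal : ∀ {v} → ¬ (y < v)
    z-upper : ∀ {n v} → z n < v → ∃ λ k → (v ≡ z k) × (k ℕ.≤ n)

<₁-isShape : IsShape _<₁_
<₁-isShape = record
  { isStrictPartialOrder = <₁-isStrictPartialOrder
  ; x-below-y = x<y
  ; y-maximal = λ ()
  ; z-upper = λ { (z<z m<n) → _ , refl , ℕ.<⇒≤ m<n }
  }

<₂-isShape : IsShape _<₂_
<₂-isShape = record
  { isStrictPartialOrder = <₂-isStrictPartialOrder
  ; x-below-y = x<y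
  ; y-maximal = λ ()
  ; z-upper = λ ()
  }

<₃-isShape : IsShape _<₃_
<₃-isShape = record
  { isStrictPartialOrder = <₃-isStrictPartialOrder
  ; x-below-y = x<y
  ; y-maximal = λ ()
  ; z-upper = λ ()
  }

module Shape {_<_ : Rel Point 0ℓ} (shape : IsShape _<_) where
  open IsShape shape

  Z : OrderedSpace 0ℓ 0ℓ 0ℓ 0ℓ 0ℓ
  Z = orderedCompactification _<_ isStrictPartialOrder

  ∅-isClopenUpset : IsClopenUpset _<_ (λ _ → Empty.⊥)
  ∅-isClopenUpset = record { upset = λ _ () ; near-x = λ () ; away-x = λ _ → 0 , λ _ _ () }

  -- These sets miss `y` and together exhaust the `z n`, so no clopen upset that misses `y` contains
  -- them all.
  segment-isClopenUpset : ∀ N → IsClopenUpset _<_ (λ u → ∃ λ k → (u ≡ z k) × (k ℕ.≤ N))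
  segment-isClopenUpset N = record
    { upset  = λ { u<v (k , refl , k≤N) → let l , v≡zl , l≤k = z-upper u<v in
                                           l , v≡zl , ℕ.≤-trans l≤k k≤N }
    ; near-x = λ { (_ , () , _) }
    ; away-x = λ _ → suc N , λ { n N<n (n , refl , n≤N) → ℕ.<⇒≱ N<n n≤N }
    }

-- The fields say that M is, up to isomorphism, the lattice of those
-- subsets of Point that are clopen upsets, and that m corresponds to {y}.
record IsDual (_<_ : Rel Point 0ℓ) {c ℓ₁ ℓ₂} (M : BoundedDistributiveLattice c ℓ₁ ℓ₂)
              (m : BoundedDistributiveLattice.Carrier M) : Set (c ⊔ ℓ₂ ⊔ Level.suc 0ℓ) where
  open BoundedDistributiveLattice M
  field
    ⟪_⟫     : Carrier → Pred Point 0ℓ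
    mono    : ∀ {a b} → a ≤ b → ⟪ a ⟫ ⊆ ⟪ b ⟫
    reflect : ∀ {a b} → ⟪ a ⟫ ⊆ ⟪ b ⟫ → a ≤ b
    isClopenUpset : ∀ a → IsClopenUpset _<_ ⟪ a ⟫
    realize : ∀ {T : Pred Point 0ℓ} → IsClopenUpset _<_ T → ∃ λ a → ⟪ a ⟫ ≐ T
    ⟪m⟫≐y   : ⟪ m ⟫ ≐ ｛ y ｝

module DualProperties {_<_ : Rel Point 0ℓ} (shape : IsShape _<_)
                      {c ℓ₁ ℓ₂ : Level} {M : BoundedDistributiveLattice c ℓ₁ ℓ₂}
                      {m : BoundedDistributiveLattice.Carrier M} (dual : IsDual _<_ M m) where
  open BoundedDistributiveLattice M renaming (refl to ≤-refl; trans to ≤-trans)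
  open IsDual dual
  open Shape shape
  open IsShape shape

  -- Only the order is assumed to be preserved and reflected; that ⊥ is preserved follows because
  -- some element realizes the empty set.
  ⟪⊥⟫-empty : ∀ {u} → u ∉ ⟪ ⊥ ⟫
  ⟪⊥⟫-empty u∈ = let a , ⟪a⟫⊆∅ , _ = realize ∅-isClopenUpset in ⟪a⟫⊆∅ (mono (minimum a) u∈)

  disjoint⇒≤⊥ : ∀ {a b} → (∀ {u} → u ∈ ⟪ a ⟫ → u ∉ ⟪ b ⟫) → (a ∧ b) ≤ ⊥
  disjoint⇒≤⊥ {a} {b} disjoint = reflect λ u∈ →
    ⊥-elim (disjoint (mono (x∧y≤x a b) u∈) (mono (x∧y≤y a b) u∈))

  y∉⇒∈I : ∀ {a} → y ∉ ⟪ a ⟫ → a ∈ I[_⟶_] M m ⊥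
  y∉⇒∈I y∉a = disjoint⇒≤⊥ λ u∈a u∈m → y∉a (≡.subst (_∈ ⟪ _ ⟫) (≡.sym (proj₁ ⟪m⟫≐y u∈m)) u∈a)

  ∈I⇒y∉ : ∀ {a} → a ∈ I[_⟶_] M m ⊥ → y ∉ ⟪ a ⟫
  ∈I⇒y∉ {a} a∧m≤⊥ y∈a = ⟪⊥⟫-empty (mono (≤-trans (∧-greatest m≤a ≤-refl) a∧m≤⊥) (proj₂ ⟪m⟫≐y refl))
    where
    m≤a : m ≤ a
    m≤a = reflect λ u∈m → ≡.subst (_∈ ⟪ a ⟫) (proj₁ ⟪m⟫≐y u∈m) y∈a

  -- A member of this ideal misses `y`, hence also `x` below it, hence some `z N`. The segment up to
  -- `z N` misses `y` as well, so it belongs to the ideal without lying below that member.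
  I-no-greatest : ¬ (∃ λ a → (a ∈ I[_⟶_] M m ⊥) × (∀ {b} → b ∈ I[_⟶_] M m ⊥ → b ≤ a))
  I-no-greatest (a , a∈I , greatest) =
    let y∉a = ∈I⇒y∉ a∈I
        N , zN∉a = eventually-some (away-x (y∉a ∘ upset x-below-y))
        b , ⟪b⟫⊆ , ⊆⟪b⟫ = realize (segment-isClopenUpset N)
    in zN∉a (mono (greatest (y∉⇒∈I λ y∈b → y∉segment (⟪b⟫⊆ y∈b)))
                  (⊆⟪b⟫ (N , refl , ℕ.≤-refl)))
    where
    open IsClopenUpset (isClopenUpset a)
    y∉segment : ∀ {N} → ¬ (∃ λ k → (y ≡ z k) × (k ℕ.≤ N))
    y∉segment (_ , () , _)

  -- The pseudocomplement of a is greatest in its annihilator. A homomorphism is monotone, so the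
  -- image would be greatest in the annihilator of `m`, against `I-no-greatest`.
  quotient⇒¬pAlgebra : ∀ {c′ ℓ₁′ ℓ₂′} (L : BoundedDistributiveLattice c′ ℓ₁′ ℓ₂′) →
                       IsPQuotient L M m → ¬ IsPAlgebra L
  quotient⇒¬pAlgebra L (h , epi , a , h[I]⊆ , ⊆h[I]) pAlgebra =
    let d , d∧a≈⊥ , greatest = pAlgebra a in
    I-no-greatest (h d , h[I]⊆ (d , L.reflexive d∧a≈⊥ , Eq.refl) , λ b∈I →
      let e , e∧a≤⊥ , he≈b = ⊆h[I] b∈I in
      ≤-trans (reflexive (Eq.sym he≈b)) (h-mono (greatest e (L.antisym e∧a≤⊥ (L.minimum _)))))
    where
    module L = BoundedDistributiveLattice L
    open LatticeMorphisms L.rawLattice rawLattice using (IsLatticeHomomorphism)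
    open IsLatticeHomomorphism (IsBoundedLatticeEpimorphism.isLatticeHomomorphism epi)

    h-mono : ∀ {d e} → d L.≤ e → h d ≤ h e
    h-mono {d} {e} d≤e = ≤-trans
      (reflexive (Eq.trans (⟦⟧-cong (L.antisym (L.∧-greatest L.refl d≤e) (L.x∧y≤x d e))) (∧-homo d e)))
      (x∧y≤y (h d) (h e))

-- Duality between the model spaces and the lattices `L₁`, `L₂`, `L₃`

module Dualities (em : ∀ {ℓ} → ExcludedMiddle ℓ) where
  open Classical em

  leaves-list : ∀ {a} {A : Set a} {f : ℕ → A} → Injective _≡_ _≡_ f →
                ∀ as → Eventually λ n → ¬ (f n List.∈ as)
  leaves-list f-inj []       = 0 , λ _ _ ()
  leaves-list {f = f} f-inj (a ∷ as) with em {P = ∃ λ k → f k ≡ a} | leaves-list f-inj as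
  ... | no ¬k          | N , f∉ = N , λ n N≤n → λ
    { (here fn≡a) → ¬k (n , fn≡a) ; (there fn∈) → f∉ n N≤n fn∈ }
  ... | yes (k , refl) | N , f∉ = suc k ℕ.⊔ N , λ n le → λ
    { (here fn≡fk) → ℕ.<-irrefl (≡.sym (f-inj fn≡fk)) (ℕ.≤-trans (ℕ.m≤m⊔n (suc k) N) le)
    ; (there fn∈)  → f∉ n (ℕ.≤-trans (ℕ.m≤n⊔m (suc k) N) le) fn∈ }

  finite⇒eventually∉ : {S : Pred ℕ 0ℓ} → Finite S → Eventually (_∉ S)
  finite⇒eventually∉ (ks , S⊆ks) = eventually-map (λ n∉ks → n∉ks ∘ S⊆ks) (leaves-list id ks)

  eventually∉⇒finite : ∀ {p} {S : Pred ℕ p} → Eventually (_∉ S) → Finite S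
  eventually∉⇒finite (N , ∉S) = upTo N , λ {n} n∈S →
    [ (λ N≤n → ⊥-elim (∉S n N≤n n∈S)) , ∈-upTo⁺ ]′ (ℕ.≤-<-connex N n)

  module _ {_<_ : Rel Point 0ℓ} (shape : IsShape _<_) where
    open Shape shape
    private module Z = OrderedSpace Z

    open⇒near-x : ∀ {t} {T : Pred Point t} → Z.Open T → x ∈ T → Eventually λ n → z n ∈ T
    open⇒near-x T-open x∈T with T-open x∈T
    ... | inj₁ _  , () , _
    ... | inj₂ ds , _ , ⊆T = eventually-map ⊆T (leaves-list (λ { refl → refl }) (map just ds))

    near-x⇒open : ∀ {t} {T : Pred Point t} → (x ∈ T → Eventually λ n → z n ∈ T) → Z.Open T
    near-x⇒open near-x {just d}  d∈T = inj₁ d , refl , λ { refl → d∈T }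
    near-x⇒open {T = T} near-x {nothing} x∈T =
      inj₂ (y′ ∷ map z′ (upTo N)) , x∉ , ⊆T
      where
      N = proj₁ (near-x x∈T)
      x∉ : ∀ {ds : List Isolated} → ¬ (x List.∈ map just ds)
      x∉ x∈ with ∈-map⁻ just x∈
      ... | _ , _ , ()
      ⊆T : ∀ {u} → ¬ (u List.∈ map just (y′ ∷ map z′ (upTo N))) → u ∈ T
      ⊆T {x}   _  = x∈T
      ⊆T {y}   u∉ = ⊥-elim (u∉ (here refl))
      ⊆T {z n} u∉ = [ proj₂ (near-x x∈T) n
                    , (λ n<N → ⊥-elim (u∉ (there (∈-map⁺ just (∈-map⁺ z′ (∈-upTo⁺ n<N)))))) ]′
                    (ℕ.≤-<-connex N n)

    -- In a p-space the preimage of ↓ S would be an open set around `x`. It would then contain some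
    -- `z n`, but it is {x, y}.
    pConfiguration⇒¬pSpace : ∀ {c ℓ₁ ℓ₂ b p} {X : OrderedSpace c ℓ₁ ℓ₂ b p} →
                             IsPConfiguration Z x y X → ¬ OrderedSpace.IsPSpace X
    pConfiguration⇒¬pSpace (e , embedding , _ , S , S-open , S-upset , _ , ↓S⊆xy , xy⊆↓S) (_ , ↓-open) =
      let open IsTopologicalEmbedding embedding
          e⁻¹↓S-open = continuous _ (↓-open S S-open S-upset)
          n , zn∈ = eventually-some (open⇒near-x e⁻¹↓S-open (xy⊆↓S (inj₁ refl)))
      in [ (λ ()) , (λ ()) ]′ (↓S⊆xy zn∈)

  L₁-isDual : IsDual _<₁_ L₁ c₁
  L₁-isDual = record
    { ⟪_⟫ = proj₁
    ; mono = id
    ; reflect = id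
    ; isClopenUpset = λ (S , (_ , S-open , ∁S-open) , ↑S⊆S , _) → record
      { upset  = λ u<v u∈S → ↑S⊆S (_ , u∈S , inj₁ u<v)
      ; near-x = open⇒near-x <₁-isShape S-open
      ; away-x = open⇒near-x <₁-isShape ∁S-open
      }
    ; realize = λ {T} T-clopen → let open IsClopenUpset T-clopen in
        ( T , ( (λ _ → em) , near-x⇒open <₁-isShape near-x , near-x⇒open <₁-isShape away-x )
        , (λ { (_ , u∈T , inj₁ u<v) → upset u<v u∈T ; (_ , u∈T , inj₂ refl) → u∈T })
        , λ u∈T → _ , u∈T , inj₂ refl ) , id , id
    ; ⟪m⟫≐y = id , id
    }

  -- The number 0 stands for `y` and `suc n` for `z n`. As `x` is the least point, an upset
  -- containing it is the whole space, which is the added top; a clopen upset without `x` is a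
  -- finite set of isolated points.
  L₂-isDual : IsDual _<₂_ L₂ c₂
  L₂-isDual = record
    { ⟪_⟫ = ⟪_⟫
    ; mono = λ {a} {b} → mono {a} {b}
    ; reflect = λ {a} {b} → reflect {a} {b}
    ; isClopenUpset = isClopenUpset
    ; realize = realize
    ; ⟪m⟫≐y = (λ { {x} () ; {y} _ → refl ; {z _} () }) , λ { refl → refl }
    }
    where
    open BoundedDistributiveLattice L₂ using (Carrier; _≤_)

    ⟪_⟫ : Carrier → Pred Point 0ℓ
    ⟪ ⊤⁺ ⟫ _            = Unit.⊤
    ⟪ [ S , _ ] ⟫ x     = Empty.⊥
    ⟪ [ S , _ ] ⟫ y     = 0 ∈ S
    ⟪ [ S , _ ] ⟫ (z n) = suc n ∈ S

    mono : ∀ {a b} → a ≤ b → ⟪ a ⟫ ⊆ ⟪ b ⟫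
    mono (_ Order⁺.≤⊤⁺)  _          = _
    mono Order⁺.[ S⊆T ] {y}   0∈S   = S⊆T 0∈S
    mono Order⁺.[ S⊆T ] {z n} 1+n∈S = S⊆T 1+n∈S

    reflect : ∀ {a b} → ⟪ a ⟫ ⊆ ⟪ b ⟫ → a ≤ b
    reflect {b = ⊤⁺} _              = _ Order⁺.≤⊤⁺
    reflect {⊤⁺} {[ _ ]} ⊆          = ⊥-elim (⊆ {x} _)
    reflect {[ S , _ ]} {[ T , _ ]} ⊆ = Order⁺.[ (λ { {zero} → ⊆ {y} ; {suc n} → ⊆ {z n} }) ]

    isClopenUpset : ∀ a → IsClopenUpset _<₂_ ⟪ a ⟫
    isClopenUpset ⊤⁺ = record
      { upset = λ _ _ → _ ; near-x = λ _ → 0 , λ _ _ → _ ; away-x = λ x∉ → ⊥-elim (x∉ _) }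
    isClopenUpset [ S , ks , S⊆ks ] = record
      { upset  = λ { x<y () ; x<z () }
      ; near-x = λ ()
      ; away-x = λ _ → eventually-map (λ n∉ks → n∉ks ∘ S⊆ks) (leaves-list ℕ.suc-injective ks)
      }

    realize : ∀ {T : Pred Point 0ℓ} → IsClopenUpset _<₂_ T → ∃ λ a → ⟪ a ⟫ ≐ T
    realize {T} T-clopen with em {P = x ∈ T}
    ... | yes x∈T = ⊤⁺ , (λ { {x} _ → x∈T ; {y} _ → upset x<y x∈T ; {z _} _ → upset x<z x∈T }) , _
      where open IsClopenUpset T-clopen
    ... | no x∉T = [ S , eventually∉⇒finite S-bounded ] ,
      (λ { {y} y∈T → y∈T ; {z _} z∈T → z∈T }) ,
      λ { {x} x∈T → x∉T x∈T ; {y} y∈T → y∈T ; {z _} z∈T → z∈T }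
      where
      open IsClopenUpset T-clopen
      S : Pred ℕ 0ℓ
      S zero    = y ∈ T
      S (suc n) = z n ∈ T
      S-bounded : Eventually (_∉ S)
      S-bounded = let N , ∉T = away-x x∉T in
        suc N , λ { (suc n) 1+N≤1+n → ∉T n (ℕ.s≤s⁻¹ 1+N≤1+n) }

  -- In a pair (A, n), A records the `z n` and n records `y`. A clopen set contains `x` exactly when
  -- A is infinite, so the condition "A finite or n = 1" is the upset condition for x < y.
  L₃-isDual : IsDual _<₃_ L₃ c₃
  L₃-isDual = record
    { ⟪_⟫ = ⟪_⟫
    ; mono = λ {a} {b} → mono {a} {b}
    ; reflect = λ {a} {b} → reflect {a} {b}
    ; isClopenUpset = isClopenUpset
    ; realize = realize
    ; ⟪m⟫≐y = (λ { {x} ¬fin → ⊥-elim (¬fin ([] , λ ())) ; {y} _ → refl ; {z _} () }) , λ { refl → refl }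
    }
    where
    open BoundedDistributiveLattice L₃ using (Carrier; _≤_)

    ⟪_⟫ : Carrier → Pred Point 0ℓ
    ⟪ ((S , _) , _) , _ ⟫ x     = ¬ Finite S
    ⟪ (_ , b) , _ ⟫       y     = b ≡ true
    ⟪ ((S , _) , _) , _ ⟫ (z n) = n ∈ S

    mono : ∀ {a b} → a ≤ b → ⟪ a ⟫ ⊆ ⟪ b ⟫
    mono (S⊆T , _) {x} S-infinite (ks , T⊆ks) = S-infinite (ks , T⊆ks ∘ S⊆T)
    mono (_ , Bool.b≤b) {y} b≡true = b≡true
    mono (S⊆T , _) {z n} n∈S = S⊆T n∈S

    reflect : ∀ {a b} → ⟪ a ⟫ ⊆ ⟪ b ⟫ → a ≤ b
    reflect {(_ , false) , _} {(_ , false) , _} ⊆ = (λ {n} → ⊆ {z n}) , Bool.b≤b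
    reflect {(_ , false) , _} {(_ , true) , _}  ⊆ = (λ {n} → ⊆ {z n}) , Bool.f≤t
    reflect {(_ , true) , _}  {(_ , true) , _}  ⊆ = (λ {n} → ⊆ {z n}) , Bool.b≤b
    reflect {(_ , true) , _}  {(_ , false) , _} ⊆ with () ← ⊆ {y} refl

    isClopenUpset : ∀ a → IsClopenUpset _<₃_ ⟪ a ⟫
    isClopenUpset (((S , S-cf) , b) , fin⊎true) = record
      { upset  = λ { x<y S-infinite → [ ⊥-elim ∘ S-infinite , id ]′ fin⊎true }
      ; near-x = λ S-infinite → eventually-map dne
          (finite⇒eventually∉ ([ ⊥-elim ∘ S-infinite , id ]′ S-cf))
      ; away-x = finite⇒eventually∉ ∘ dne
      }

    realize : ∀ {T : Pred Point 0ℓ} → IsClopenUpset _<₃_ T → ∃ λ a → ⟪ a ⟫ ≐ T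
    realize {T} T-clopen = (((S , S-cf) , does y∈T?) , S∈L₃) , ⊆T , T⊆
      where
      open IsClopenUpset T-clopen
      S : Pred ℕ 0ℓ
      S n = z n ∈ T

      y∈T? : Dec (y ∈ T)
      y∈T? = em

      S-finite : x ∉ T → Finite S
      S-finite x∉T = eventually∉⇒finite (away-x x∉T)

      S-infinite : x ∈ T → ¬ Finite S
      S-infinite x∈T S-fin =
        let n , n∈S , n∉S = eventually-some (eventually-× (near-x x∈T) (finite⇒eventually∉ S-fin))
        in n∉S n∈S

      S-cf : Finite S ⊎ Cofinite S
      S-cf with em {P = x ∈ T}
      ... | yes x∈T = inj₂ (eventually∉⇒finite (eventually-map (λ n∈S n∉S → n∉S n∈S) (near-x x∈T)))
      ... | no x∉T  = inj₁ (S-finite x∉T)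

      S∈L₃ : InL₃ ((S , S-cf) , does y∈T?)
      S∈L₃ with em {P = x ∈ T}
      ... | yes x∈T = inj₂ (dec-true y∈T? (upset x<y x∈T))
      ... | no x∉T  = inj₁ (S-finite x∉T)

      ⊆T : ⟪ ((S , S-cf) , does y∈T?) , S∈L₃ ⟫ ⊆ T
      ⊆T {x} S-inf = dne λ x∉T → S-inf (S-finite x∉T)
      ⊆T {y} y∈    = dne λ y∉T → case ≡.trans (≡.sym (dec-false y∈T? y∉T)) y∈ of λ ()
      ⊆T {z n} n∈S = n∈S

      T⊆ : T ⊆ ⟪ ((S , S-cf) , does y∈T?) , S∈L₃ ⟫
      T⊆ {x} x∈T   = S-infinite x∈T
      T⊆ {y} y∈T   = dec-true y∈T? y∈T
      T⊆ {z n} n∈T = n∈T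

-- Convergent sequences that obstruct pseudocomplements

module _ {c ℓ₁ ℓ₂ : Level} (L : BoundedDistributiveLattice c ℓ₁ ℓ₂) where
  open BoundedDistributiveLattice L
  open PrimeFilter

  -- A sequence in the open set of those points outside ↓ (α a) that converges
  -- to a point x ∈ ↓ (α a).  That 𝐳 n is outside is witnessed by w n, and w∉𝐳
  -- makes the 𝐳 n distinct and rules out ascending pairs.
  record Obstruction (a : Carrier) : Set (Level.suc (c ⊔ ℓ₁ ⊔ ℓ₂)) where
    field
      𝐱 𝐲 : PrimeFilter L
      𝐳   : ℕ → PrimeFilter L
      a∈𝐲 : a ∈ Member 𝐲
      𝐱⊆𝐲 : Member 𝐱 ⊆ Member 𝐲
      limit∈ : ∀ {b} → b ∈ Member 𝐱 → Eventually λ n → b ∈ Member (𝐳 n)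
      limit∉ : ∀ {b} → b ∉ Member 𝐱 → Eventually λ n → b ∉ Member (𝐳 n)
      w      : ℕ → Carrier
      w∈I    : ∀ n → w n ∈ I[_⟶_] L a ⊥
      w∈𝐳    : ∀ n → w n ∈ Member (𝐳 n)
      w∉𝐳    : ∀ {m n} → m ℕ.< n → w m ∉ Member (𝐳 n)

    point : Point → PrimeFilter L
    point x     = 𝐱
    point y     = 𝐲
    point (z n) = 𝐳 n

  subsequence : ∀ {a} (O : Obstruction a) (s : ℕ → ℕ) → (∀ {m n} → m ℕ.< n → s m ℕ.< s n) →
                Obstruction a
  subsequence O s s-mono = record
    { 𝐱 = 𝐱
    ; 𝐲 = 𝐲
    ; 𝐳 = 𝐳 ∘ s
    ; a∈𝐲 = a∈𝐲
    ; 𝐱⊆𝐲 = 𝐱⊆𝐲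
    ; limit∈ = eventually-∘ ∘ limit∈
    ; limit∉ = eventually-∘ ∘ limit∉
    ; w = w ∘ s
    ; w∈I = w∈I ∘ s
    ; w∈𝐳 = w∈𝐳 ∘ s
    ; w∉𝐳 = w∉𝐳 ∘ s-mono
    }
    where
    open Obstruction O
    eventually-∘ : ∀ {p} {P : Pred ℕ p} → Eventually P → Eventually (P ∘ s)
    eventually-∘ (N , P-holds) = N , λ n N≤n →
      P-holds (s n) (ℕ.≤-trans N≤n (increasing⇒inflationary s-mono n))

  -- Of the implications from inclusion to order, only those that depend on the shape are required.
  -- The others are settled in `⊆⇒≤` by `a`, the `w n` and x < y.
  record HasOrder {a : Carrier} (O : Obstruction a) (_<_ : Rel Point 0ℓ)
         : Set (c ⊔ ℓ₁ ⊔ ℓ₂) where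
    open Obstruction O
    field
      <⇒⊆ : ∀ {u v} → u < v → Member (point u) ⊆ Member (point v)
      𝐱⊆𝐳⇒< : ∀ {n} → Member 𝐱 ⊆ Member (𝐳 n) → x < z n
      𝐳⊆𝐳⇒≤ : ∀ {m n} → Member (𝐳 m) ⊆ Member (𝐳 n) → z m < z n ⊎ z m ≡ z n

  module _ {a : Carrier} (O : Obstruction a) where
    open Obstruction O

    w∉𝐲 : ∀ n → w n ∉ Member 𝐲
    w∉𝐲 n w∈𝐲 = proper 𝐲 (upward 𝐲 (w∈I n) (∧-closed 𝐲 w∈𝐲 a∈𝐲))

    a∉𝐳 : ∀ n → a ∉ Member (𝐳 n)
    a∉𝐳 n a∈𝐳 = proper (𝐳 n) (upward (𝐳 n) (w∈I n) (∧-closed (𝐳 n) (w∈𝐳 n) a∈𝐳))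

    a∉𝐱 : a ∉ Member 𝐱
    a∉𝐱 a∈𝐱 = let n , a∈𝐳 = eventually-some (limit∈ a∈𝐱) in a∉𝐳 n a∈𝐳

-- From an ordered obstruction to a p-configuration and a quotient

module Configurations (em : ∀ {ℓ} → ExcludedMiddle ℓ) {_<_ : Rel Point 0ℓ} (shape : IsShape _<_)
                      {c ℓ₁ ℓ₂ : Level} (L : BoundedDistributiveLattice c ℓ₁ ℓ₂)
                      {a : BoundedDistributiveLattice.Carrier L} (O : Obstruction L a)
                      (hasOrder : HasOrder L O _<_) where
  open Classical em
  open Dualities em
  open IsShape shape
  open Shape shape
  open BoundedDistributiveLattice L renaming (refl to ≤-refl; trans to ≤-trans)
  open PrimeFilter
  open Obstruction O
  open HasOrder hasOrder

  private
    module X = OrderedSpace (PriestleySpace L)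
    module Z = OrderedSpace Z

  ≤⇒⊆ : ∀ {u v} → u Z.≤ v → Member (point u) ⊆ Member (point v)
  ≤⇒⊆ (inj₁ u<v)  = <⇒⊆ u<v
  ≤⇒⊆ (inj₂ refl) = id

  ⊆⇒≤ : ∀ {u v} → Member (point u) ⊆ Member (point v) → u Z.≤ v
  ⊆⇒≤ {x}   {x}   _ = inj₂ refl
  ⊆⇒≤ {x}   {y}   _ = inj₁ x-below-y
  ⊆⇒≤ {x}   {z n} ⊆ = inj₁ (𝐱⊆𝐳⇒< ⊆)
  ⊆⇒≤ {y}   {x}   ⊆ = ⊥-elim (a∉𝐱 L O (⊆ a∈𝐲))
  ⊆⇒≤ {y}   {y}   _ = inj₂ refl
  ⊆⇒≤ {y}   {z n} ⊆ = ⊥-elim (a∉𝐳 L O n (⊆ a∈𝐲))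
  ⊆⇒≤ {z n} {x}   ⊆ = ⊥-elim (w∉𝐲 L O n (𝐱⊆𝐲 (⊆ (w∈𝐳 n))))
  ⊆⇒≤ {z n} {y}   ⊆ = ⊥-elim (w∉𝐲 L O n (⊆ (w∈𝐳 n)))
  ⊆⇒≤ {z m} {z n} ⊆ = 𝐳⊆𝐳⇒≤ ⊆

  point-injective : ∀ {u v} → Member (point u) ≐ Member (point v) → u ≡ v
  point-injective (⊆ , ⊇) = Z.antisym (⊆⇒≤ ⊆) (⊆⇒≤ ⊇)

  -- Compact into Hausdorff: each point outside T is excluded from some basic neighbourhood of
  -- `point t`. Basic sets are clopen, so excluding `x` excludes almost all `z n`, and by
  -- compactness one neighbourhood excludes everything outside T.
  basic-nbhd : ∀ {T : Pred Point 0ℓ} → Z.Open T → ∀ t → t ∈ T → ∃ λ B →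
               (point t ∈ X.⟦ B ⟧) × (∀ u → point u ∈ X.⟦ B ⟧ → u ∈ T)
  basic-nbhd {T} T-open t t∈T =
    let (B , t∈B) , excludes = points-compact {R = λ (B , _) → Excludes B} _⊕_
          (λ v e v∉T (f∧f′ , j∨j′) →
            e v∉T (upward (point v) (x∧y≤x _ _) f∧f′ , j∨j′ ∘ upward (point v) (x≤x∨y _ _)))
          (λ v e v∉T (f∧f′ , j∨j′) →
            e v∉T (upward (point v) (x∧y≤y _ _) f∧f′ , j∨j′ ∘ upward (point v) (y≤x∨y _ _)))
          (λ {(B , _)} → near-x B) excluded
    in B , t∈B , λ u u∈B → dne λ u∉T → excludes u u∉T u∈B
    where
    Nbhd : Set _
    Nbhd = ∃ λ B → point t ∈ X.⟦ B ⟧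

    Excludes : X.Base → Pred Point _
    Excludes B u = u ∉ T → point u ∉ X.⟦ B ⟧

    _⊕_ : Nbhd → Nbhd → Nbhd
    ((f , j) , f∈ , j∉) ⊕ ((f′ , j′) , f′∈ , j′∉) = (f ∧ f′ , j ∨ j′) ,
      ∧-closed (point t) f∈ f′∈ , [ j∉ , j′∉ ]′ ∘ prime (point t)

    near-x : ∀ B → x ∈ Excludes B → Eventually λ n → z n ∈ Excludes B
    near-x (f , j) x∈ with em {P = x ∈ T} | em {P = f ∈ Member 𝐱}
    ... | yes x∈T | _       = eventually-map (λ z∈T z∉T → ⊥-elim (z∉T z∈T)) (open⇒near-x shape T-open x∈T)
    ... | no _    | no f∉𝐱  = eventually-map (λ f∉𝐳 _ (f∈𝐳 , _) → f∉𝐳 f∈𝐳) (limit∉ f∉𝐱)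
    ... | no x∉T  | yes f∈𝐱 = eventually-map (λ j∈𝐳 _ (_ , j∉𝐳) → j∉𝐳 j∈𝐳)
                                             (limit∈ (dne λ j∉𝐱 → x∈ x∉T (f∈𝐱 , j∉𝐱)))

    excluded : ∀ u → ∃ λ ((B , _) : Nbhd) → u ∈ Excludes B
    excluded u with em {P = u ∈ T}
                  | em {P = Member (point t) ⊆ Member (point u)}
                  | em {P = Member (point u) ⊆ Member (point t)}
    ... | yes u∈T | _      | _ = let B , t∈B = X.covers (point t) in
                                 (B , t∈B) , λ u∉T → ⊥-elim (u∉T u∈T)
    ... | no u∉T  | yes ⊆  | yes ⊇ = ⊥-elim (u∉T (≡.subst (_∈ T) (point-injective (⊆ , ⊇)) t∈T))
    ... | no _    | no ⊈   | _ = let f , f∈ , f∉ = ⊈⇒∃ ⊈ in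
                                 ((f , ⊥) , f∈ , proper (point t)) , λ _ (f∈′ , _) → f∉ f∈′
    ... | no _    | yes _  | no ⊉ = let j , j∈ , j∉ = ⊈⇒∃ ⊉ in
                                    ((⊤ , j) , ⊤-member (point t) , j∉) , λ _ (_ , j∉′) → j∉′ j∈

  isTopologicalEmbedding : IsTopologicalEmbedding Z (PriestleySpace L) point
  isTopologicalEmbedding = record
    { cong       = λ { refl → id , id }
    ; injective  = point-injective
    ; continuous = λ S S-open → near-x⇒open shape λ x∈S →
        let _ , (f∈ , j∉) , ⊆S = S-open x∈S
        in eventually-map (λ 𝐳∈ → ⊆S 𝐳∈) (eventually-× (limit∈ f∈) (limit∉ j∉))
    ; open-image = λ T T-open →
        -- The largest open set whose preimage lies in T.
        (λ F → Lift X.size (∃ λ B → (F ∈ X.⟦ B ⟧) × (∀ u → point u ∈ X.⟦ B ⟧ → u ∈ T)))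
        , (λ (lift (B , F∈B , ⊆T)) → B , F∈B , λ {G} G∈B → lift (B , G∈B , ⊆T))
        , (λ {u} u∈T → lift (basic-nbhd T-open u u∈T))
        , λ {u} (lift (B , u∈B , ⊆T)) → ⊆T u u∈B
    }

  pConfiguration : IsPConfiguration Z x y (PriestleySpace L)
  pConfiguration = point , isTopologicalEmbedding , isOrderEmbedding , U
    , (λ {F} (lift a∈F) → (a , ⊥) , (a∈F , proper F) , λ (a∈G , _) → lift a∈G)
    , ((λ (_ , lift a∈F , F⊆G) → lift (F⊆G a∈F)) , λ {F} a∈F → F , a∈F , id)
    , lift a∈𝐲
    , (λ {u} → ↓U⊆ u)
    , λ { (inj₁ refl) → 𝐲 , lift a∈𝐲 , 𝐱⊆𝐲 ; (inj₂ refl) → 𝐲 , lift a∈𝐲 , id }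
    where
    U : Pred (PrimeFilter L) X.size
    U F = Lift X.size (a ∈ Member F)

    isOrderEmbedding : IsOrderEmbedding Z (PriestleySpace L) point
    isOrderEmbedding = record
      { isOrderHomomorphism = record { cong = λ { refl → id , id } ; mono = ≤⇒⊆ }
      ; injective = point-injective
      ; cancel = ⊆⇒≤
      }

    ↓U⊆ : ∀ u → point u ∈ X.↓ U → (u ≡ x) ⊎ (u ≡ y)
    ↓U⊆ x     _ = inj₁ refl
    ↓U⊆ y     _ = inj₂ refl
    ↓U⊆ (z n) (F , lift a∈F , 𝐳⊆F) =
      ⊥-elim (proper F (upward F (w∈I n) (∧-closed F (𝐳⊆F (w∈𝐳 n)) a∈F)))

  trace : Carrier → Pred Point (c ⊔ ℓ₁ ⊔ ℓ₂)
  trace b u = b ∈ Member (point u)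

  trace-isClopenUpset : ∀ b → IsClopenUpset _<_ (trace b)
  trace-isClopenUpset b = record { upset = λ u<v → <⇒⊆ u<v ; near-x = limit∈ ; away-x = limit∉ }

  module _ {t} {T : Pred Point t} (T-clopen : IsClopenUpset _<_ T) where
    open IsClopenUpset T-clopen

    -- For v outside the upset T, u ≤ v fails, so some element contains `point u` at u but not at v.
    -- Compactness reduces the meet over all such v to a finite one.
    separate : ∀ u → u ∈ T → ∃ λ b → (u ∈ trace b) × (∀ v → v ∉ T → v ∉ trace b)
    separate u u∈T =
      let (b , u∈b) , avoids = points-compact {R = λ (b , _) → Avoids b}
            (λ (b , u∈b) (d , u∈d) → b ∧ d , ∧-closed (point u) u∈b u∈d)
            (λ v b∌ v∉T b∧d∋ → b∌ v∉T (upward (point v) (x∧y≤x _ _) b∧d∋))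
            (λ v d∌ v∉T b∧d∋ → d∌ v∉T (upward (point v) (x∧y≤y _ _) b∧d∋))
            (λ {(b , _)} → near b) avoided
      in b , u∈b , avoids
      where
      Avoids : Carrier → Pred Point _
      Avoids b v = v ∉ T → v ∉ trace b

      near : ∀ b → x ∈ Avoids b → Eventually λ n → z n ∈ Avoids b
      near b b∌x with em {P = x ∈ T}
      ... | yes x∈T = eventually-map (λ z∈T z∉T → ⊥-elim (z∉T z∈T)) (near-x x∈T)
      ... | no x∉T  = eventually-map (λ b∌z _ → b∌z) (limit∉ (b∌x x∉T))

      avoided : ∀ v → ∃ λ ((b , _) : ∃ λ b → u ∈ trace b) → v ∈ Avoids b
      avoided v with em {P = v ∈ T} | em {P = Member (point u) ⊆ Member (point v)}
      ... | yes v∈T | _     = (⊤ , ⊤-member (point u)) , λ v∉T → ⊥-elim (v∉T v∈T)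
      ... | no _    | no ⊈  = let b , u∈b , v∉b = ⊈⇒∃ ⊈ in (b , u∈b) , λ _ → v∉b
      ... | no v∉T  | yes ⊆ with ⊆⇒≤ {u} {v} ⊆
      ...   | inj₁ u<v  = ⊥-elim (v∉T (upset u<v u∈T))
      ...   | inj₂ refl = ⊥-elim (v∉T u∈T)

    -- A finite join of the elements from `separate`. This is surjectivity of restriction to an
    -- order-embedded compact subspace.
    interpolate : ∃ λ b → trace b ≐ T
    interpolate =
      let (b , b⊆T) , T⊆b = points-compact {R = λ (b , _) → Contains b}
            (λ (b , b⊆T) (d , d⊆T) → b ∨ d , λ v v∉T → [ b⊆T v v∉T , d⊆T v v∉T ]′ ∘ prime (point v))
            (λ v b∋ v∈T → upward (point v) (x≤x∨y _ _) (b∋ v∈T))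
            (λ v d∋ v∈T → upward (point v) (y≤x∨y _ _) (d∋ v∈T))
            (λ {(b , _)} → near b) contained
      in b , (λ {v} v∈b → dne λ v∉T → b⊆T v v∉T v∈b) , λ {v} → T⊆b v
      where
      Contains : Carrier → Pred Point _
      Contains b v = v ∈ T → v ∈ trace b

      near : ∀ b → x ∈ Contains b → Eventually λ n → z n ∈ Contains b
      near b b∋x with em {P = x ∈ T}
      ... | yes x∈T = eventually-map (λ b∋z _ → b∋z) (limit∈ (b∋x x∈T))
      ... | no x∉T  = eventually-map (λ z∉T z∈T → ⊥-elim (z∉T z∈T)) (away-x x∉T)

      contained : ∀ v → ∃ λ ((b , _) : ∃ λ b → ∀ v → v ∉ T → v ∉ trace b) → v ∈ Contains b
      contained v with em {P = v ∈ T}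
      ... | yes v∈T = let b , v∈b , b⊆T = separate v v∈T in (b , b⊆T) , λ _ → v∈b
      ... | no v∉T  = (⊥ , λ u _ → proper (point u)) , λ v∈T → ⊥-elim (v∉T v∈T)

    -- T misses `y`, hence `x`, hence almost all `z n`; a finite join of the witnesses `w n` covers
    -- the rest.
    annihilator⊇ : y ∉ T → ∃ λ d → (d ∈ I[_⟶_] L a ⊥) × (T ⊆ trace d)
    annihilator⊇ y∉T =
      let (d , d∈I) , T⊆d = points-compact
            {A = ∃ λ d → d ∈ I[_⟶_] L a ⊥} {R = λ (d , _) v → v ∈ T → v ∈ trace d}
            (λ (d , d∈I) (e , e∈I) → d ∨ e , I-∨-closed L d∈I e∈I)
            (λ v d∋ v∈T → upward (point v) (x≤x∨y _ _) (d∋ v∈T))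
            (λ v e∋ v∈T → upward (point v) (y≤x∨y _ _) (e∋ v∈T))
            (λ _ → eventually-map (λ z∉T z∈T → ⊥-elim (z∉T z∈T)) (away-x x∉T))
            λ { x → (⊥ , x∧y≤x ⊥ a) , λ x∈T → ⊥-elim (x∉T x∈T)
              ; y → (⊥ , x∧y≤x ⊥ a) , λ y∈T → ⊥-elim (y∉T y∈T)
              ; (z n) → (w n , w∈I n) , λ _ → w∈𝐳 n }
      in d , d∈I , λ {v} → T⊆d v
      where
      x∉T : x ∉ T
      x∉T = y∉T ∘ upset x-below-y

  module _ {c′ ℓ₁′ ℓ₂′ : Level} {M : BoundedDistributiveLattice c′ ℓ₁′ ℓ₂′}
           {m : BoundedDistributiveLattice.Carrier M} (dual : IsDual _<_ M m) where
    private module M = BoundedDistributiveLattice M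
    open IsDual dual
    open DualProperties shape dual

    private
      -- `realize` takes predicates of the lowest level, whereas `trace b` lives at the level of
      -- `L`. Deciding membership brings it down.
      resized : Carrier → Pred Point 0ℓ
      resized b u = True (em {P = u ∈ trace b})

      resized-isClopenUpset : ∀ b → IsClopenUpset _<_ (resized b)
      resized-isClopenUpset b = let open IsClopenUpset (trace-isClopenUpset b) in record
        { upset  = λ u<v → fromWitness ∘ upset u<v ∘ toWitness
        ; near-x = eventually-map fromWitness ∘ near-x ∘ toWitness
        ; away-x = λ x∉ → eventually-map (_∘ toWitness) (away-x (x∉ ∘ fromWitness))
        }

      realized : ∀ b → ∃ λ d → ⟪ d ⟫ ≐ resized b
      realized b = realize (resized-isClopenUpset b)

    restrict : Carrier → M.Carrier
    restrict b = proj₁ (realized b)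

    ⟪restrict⟫ : ∀ b → ⟪ restrict b ⟫ ≐ trace b
    ⟪restrict⟫ b = let _ , ⊆ , ⊇ = realized b in (λ u∈ → toWitness (⊆ u∈)) , λ u∈ → ⊇ (fromWitness u∈)

    restrict-≤ : ∀ {b d} → trace b ⊆ ⟪ d ⟫ → restrict b M.≤ d
    restrict-≤ {b} b⊆d = reflect λ u∈ → b⊆d (proj₁ (⟪restrict⟫ b) u∈)

    ≤-restrict : ∀ {b d} → ⟪ d ⟫ ⊆ trace b → d M.≤ restrict b
    ≤-restrict {b} d⊆b = reflect λ u∈ → proj₂ (⟪restrict⟫ b) (d⊆b u∈)

    restrict-mono : ∀ {b d} → b ≤ d → restrict b M.≤ restrict d
    restrict-mono {b} {d} b≤d = restrict-≤ λ {u} u∈b →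
      proj₂ (⟪restrict⟫ d) (upward (point u) b≤d u∈b)

    restrict-epimorphism : IsBoundedLatticeEpimorphism L M restrict
    restrict-epimorphism = record
      { isLatticeHomomorphism = record
        { isRelHomomorphism = record { cong = restrict-cong }
        ; ∧-homo = λ b d → M.antisym
            (M.∧-greatest (restrict-mono (x∧y≤x b d)) (restrict-mono (x∧y≤y b d)))
            (≤-restrict λ {u} u∈ → ∧-closed (point u)
              (proj₁ (⟪restrict⟫ b) (mono (M.x∧y≤x _ _) u∈))
              (proj₁ (⟪restrict⟫ d) (mono (M.x∧y≤y _ _) u∈)))
        ; ∨-homo = λ b d → M.antisym
            (restrict-≤ λ {u} u∈ →
              [ mono (M.x≤x∨y _ _) ∘ proj₂ (⟪restrict⟫ b) , mono (M.y≤x∨y _ _) ∘ proj₂ (⟪restrict⟫ d) ]′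
              (prime (point u) u∈))
            (M.∨-least (restrict-mono (x≤x∨y b d)) (restrict-mono (y≤x∨y b d)))
        }
      ; ⊤-homo = M.antisym (M.maximum _) (≤-restrict λ {u} _ → ⊤-member (point u))
      ; ⊥-homo = M.antisym (restrict-≤ λ {u} u∈⊥ → ⊥-elim (proper (point u) u∈⊥)) (M.minimum _)
      ; surjective = λ d → let b , ⊆ , ⊇ = interpolate (isClopenUpset d) in
          b , λ e≈b → M.Eq.trans (restrict-cong e≈b) (M.antisym (restrict-≤ ⊆) (≤-restrict ⊇))
      }
      where
      restrict-cong : ∀ {b d} → b ≈ d → restrict b M.≈ restrict d
      restrict-cong b≈d = M.antisym (restrict-mono (reflexive b≈d)) (restrict-mono (reflexive (Eq.sym b≈d)))

    pQuotient : IsPQuotient L M m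
    pQuotient = restrict , restrict-epimorphism , a
      , (λ (b , b∈I , b≈d) → y∉⇒∈I λ y∈d → proper 𝐲 (upward 𝐲 b∈I
          (∧-closed 𝐲 (proj₁ (⟪restrict⟫ b) (mono (M.reflexive (M.Eq.sym b≈d)) y∈d)) a∈𝐲)))
      , λ {d} d∈I →
          -- An element with the right trace need not annihilate `a` in `L`. Its meet with `e`,
          -- which annihilates `a` and contains the trace, does, and the trace is unchanged.
          let b , b⊆d , d⊆b = interpolate (isClopenUpset d)
              e , e∈I , d⊆e = annihilator⊇ (isClopenUpset d) (∈I⇒y∉ d∈I)
          in b ∧ e
           , ≤-trans (∧-greatest (≤-trans (x∧y≤x _ a) (x∧y≤y b e)) (x∧y≤y _ a)) e∈I
           , M.antisym (restrict-≤ λ {u} u∈b∧e → b⊆d (upward (point u) (x∧y≤x b e) u∈b∧e))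
                       (≤-restrict λ {u} u∈d → ∧-closed (point u) (d⊆b u∈d) (d⊆e u∈d))

-- Passing to an ordered subsequence

module _ (em : ∀ {ℓ} → ExcludedMiddle ℓ) {c ℓ₁ ℓ₂ : Level}
         (L : BoundedDistributiveLattice c ℓ₁ ℓ₂) where
  open Classical em
  open BoundedDistributiveLattice L renaming (refl to ≤-refl; trans to ≤-trans)
  open PrimeFilter

  eventually⊎frequently : ∀ {p} (P : Pred ℕ p) → Eventually (_∉ P) ⊎ Frequently P
  eventually⊎frequently P with em {P = Eventually (_∉ P)}
  ... | yes never = inj₁ never
  ... | no ¬never = inj₂ λ N → dne λ ¬∃ → ¬never (N , λ n N≤n Pn → ¬∃ (n , N≤n , Pn))

  module _ {a : Carrier} (O : Obstruction L a) where
    open Obstruction O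

    private
      𝐳⊆𝐳⇒≥ : ∀ {m n} → Member (𝐳 m) ⊆ Member (𝐳 n) → n ℕ.≤ m
      𝐳⊆𝐳⇒≥ {m} ⊆ = ℕ.≮⇒≥ λ m<n → w∉𝐳 m<n (⊆ (w∈𝐳 m))

    chain⇒order : (∀ {m n} → m ℕ.< n → Member (𝐳 n) ⊆ Member (𝐳 m)) → HasOrder L O _<₁_
    chain⇒order chain = record
      { <⇒⊆ = λ { x<y → 𝐱⊆𝐲 ; (x<z {n}) → 𝐱⊆𝐳 n ; (z<z m<n) → chain m<n }
      ; 𝐱⊆𝐳⇒< = λ _ → x<z
      ; 𝐳⊆𝐳⇒≤ = λ ⊆ → Sum.map z<z (≡.cong (λ k → z k) ∘ ≡.sym) (ℕ.m≤n⇒m<n∨m≡n (𝐳⊆𝐳⇒≥ ⊆))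
      }
      where
      𝐱⊆𝐳 : ∀ n → Member 𝐱 ⊆ Member (𝐳 n)
      -- The limit of a descending chain lies below the chain: `b` belongs to some later point, and
      -- that point is contained in `𝐳 n`.
      𝐱⊆𝐳 n b∈𝐱 = let N , b∈𝐳 = limit∈ b∈𝐱 in
        chain {n} {suc n ℕ.⊔ N} (ℕ.m≤m⊔n (suc n) N) (b∈𝐳 _ (ℕ.m≤n⊔m (suc n) N))

    module _ (peaks : ∀ {m n} → m ℕ.< n → ¬ (Member (𝐳 n) ⊆ Member (𝐳 m))) where
      private
        antichain : ∀ {m n} → Member (𝐳 m) ⊆ Member (𝐳 n) → z m ≡ z n
        antichain ⊆ = ≡.cong (λ k → z k) (ℕ.≤-antisym (ℕ.≮⇒≥ λ n<m → peaks n<m ⊆) (𝐳⊆𝐳⇒≥ ⊆))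

      fan⇒order : (∀ n → Member 𝐱 ⊆ Member (𝐳 n)) → HasOrder L O _<₂_
      fan⇒order 𝐱⊆𝐳 = record
        { <⇒⊆ = λ { x<y → 𝐱⊆𝐲 ; (x<z {n}) → 𝐱⊆𝐳 n }
        ; 𝐱⊆𝐳⇒< = λ _ → x<z
        ; 𝐳⊆𝐳⇒≤ = inj₂ ∘ antichain
        }

      discrete⇒order : (∀ n → ¬ (Member 𝐱 ⊆ Member (𝐳 n))) → HasOrder L O _<₃_
      discrete⇒order 𝐱⊈𝐳 = record
        { <⇒⊆ = λ { x<y → 𝐱⊆𝐲 }
        ; 𝐱⊆𝐳⇒< = λ {n} ⊆ → ⊥-elim (𝐱⊈𝐳 n ⊆)
        ; 𝐳⊆𝐳⇒≤ = inj₂ ∘ antichain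
        }

  Ordered : Carrier → Rel Point 0ℓ → Set (Level.suc (c ⊔ ℓ₁ ⊔ ℓ₂))
  Ordered a _<_ = ∃ λ (O : Obstruction L a) → HasOrder L O _<_

  -- Call n a peak if no later 𝐳 k lies below 𝐳 n.  Infinitely many peaks form
  -- an antichain; if there are only finitely many, every later index has a
  -- still later one below it, which yields a descending chain.
  ordered-subsequence : ∀ {a} → Obstruction L a →
                        Ordered a _<₁_ ⊎ Ordered a _<₂_ ⊎ Ordered a _<₃_
  ordered-subsequence {a} O = by-peaks (eventually⊎frequently Peak) (eventually⊎frequently (Peak ∩ Fan))
    where
    open Obstruction O

    Peak Fan : Pred ℕ (c ⊔ ℓ₁ ⊔ ℓ₂)
    Peak n = ∀ {k} → n ℕ.< k → ¬ (Member (𝐳 k) ⊆ Member (𝐳 n))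
    Fan n = Member 𝐱 ⊆ Member (𝐳 n)

    Below : Rel ℕ (c ⊔ ℓ₁ ⊔ ℓ₂)
    Below m n = (m ℕ.< n) × (Member (𝐳 n) ⊆ Member (𝐳 m))

    below : ∀ {n} → n ∉ Peak → ∃ (Below n)
    below ¬peak = dne λ ¬∃ → ¬peak λ {k} n<k k⊆n → ¬∃ (k , n<k , λ {b} → k⊆n {b})

    by-peaks : Eventually (_∉ Peak) ⊎ Frequently Peak →
               Eventually (_∉ (Peak ∩ Fan)) ⊎ Frequently (Peak ∩ Fan) →
               Ordered a _<₁_ ⊎ Ordered a _<₂_ ⊎ Ordered a _<₃_
    by-peaks (inj₁ (N , ¬peak)) _ =
      let s , _ , s-chain = iterate {Q = N ℕ.≤_} {R = Below}
            (λ (i<j , j⊆i) (j<k , k⊆j) → ℕ.<-trans i<j j<k , λ {b} → j⊆i {b} ∘ k⊆j {b})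
            (λ {i} N≤i → let j , i<j , j⊆i = below (¬peak i N≤i) in
              j , ℕ.≤-trans N≤i (ℕ.<⇒≤ i<j) , i<j , λ {b} → j⊆i {b})
            (N , ℕ.≤-refl)
          O′ = subsequence L O s (proj₁ ∘ s-chain)
      in inj₁ (O′ , chain⇒order O′ (λ m<n → proj₂ (s-chain m<n)))
    by-peaks (inj₂ _) (inj₂ often) =
      let s , s-peak-fan , s-mono = frequently⇒subsequence often
          O′ = subsequence L O s s-mono
      in inj₂ (inj₁ (O′ , fan⇒order O′ (λ {m} m<n → proj₁ (s-peak-fan m) (s-mono m<n))
                                       (λ n → proj₂ (s-peak-fan n))))
    by-peaks (inj₂ often) (inj₁ never) =
      let s , s-peak , s-mono = frequently⇒subsequence (frequently-∩ often never)
          O′ = subsequence L O s s-mono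
      in inj₂ (inj₂ (O′ , discrete⇒order O′
           (λ {m} m<n → proj₁ (s-peak m) (s-mono m<n))
           (λ n ⊆ → let peak , ¬both = s-peak n in ¬both ((λ {k} → peak {k}) , λ {b} → ⊆ {b}))))

-- Constructing the obstruction

module _ (em : ∀ {ℓ} → ExcludedMiddle ℓ) {c ℓ₁ ℓ₂ : Level}
         (L : BoundedDistributiveLattice c ℓ₁ ℓ₂)
         (countable : Countable (BoundedDistributiveLattice.setoid L)) where
  open Classical em
  open PrimeFilters em L countable
  open BoundedDistributiveLattice L renaming (refl to ≤-refl; trans to ≤-trans)
  open PrimeFilter

  -- Small f j says that the part of the open set ⋃ {α d ∣ d ∈ I} inside
  -- α f ∖ α j is covered by a single α d; a large point lies in the closure of
  -- this open set but not in the set itself.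
  ¬pseudocomplement⇒obstruction : ∀ {a} → (∀ {d} → d ∈ I[_⟶_] L a ⊥ →
    ∃ λ d′ → (d′ ∈ I[_⟶_] L a ⊥) × ¬ (d′ ≤ d)) → Obstruction L a
  ¬pseudocomplement⇒obstruction {a} unbounded = record
    { 𝐱 = filter
    ; 𝐲 = proj₁ extended
    ; 𝐳 = λ n → proj₁ (separated n)
    ; a∈𝐲 = proj₂ (proj₂ extended)
    ; 𝐱⊆𝐲 = proj₁ (proj₂ extended)
    ; limit∈ = λ b∈ → let N , A≤b , _ = base-generates b∈ (proper filter) in
        N , λ n N≤n → upward (proj₁ (separated n)) (≤-trans (proj₁ (base-decreasing N≤n)) A≤b) (A∈𝐳 n)
    ; limit∉ = λ b∉ → let N , _ , b≤B = base-generates f∈ b∉ in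
        N , λ n N≤n → B∉𝐳 n ∘ upward (proj₁ (separated n)) (≤-trans b≤B (proj₂ (base-decreasing N≤n)))
    ; w = w
    ; w∈I = λ n → proj₁ (proj₂ (fresh n))
    ; w∈𝐳 = w∈𝐳
    ; w∉𝐳 = λ {m} {n} m<n → D∉𝐳 n ∘ upward (proj₁ (separated n)) (w≤D (ℕ.≤⇒≤′ m<n))
    }
    where
    I : Pred Carrier ℓ₂
    I = I[_⟶_] L a ⊥

    Small : Carrier → Carrier → Set (c ⊔ ℓ₂)
    Small f j = ∃ λ d → (d ∈ I) × (∀ {d′} → d′ ∈ I → (f ∧ d′) ≤ (j ∨ d))

    ideal : IsClopenIdeal L Small
    ideal = record
      { empty  = λ {f} {j} f≤j → ⊥ , x∧y≤x ⊥ a , λ {d′} _ →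
          ≤-trans (x∧y≤x f d′) (≤-trans f≤j (x≤x∨y j ⊥))
      ; shrink = λ {f} {f′} {j} {j′} f′≤f j≤j′ (d , d∈I , bound) → d , d∈I , λ {d′} d′∈I →
          ≤-trans (∧-greatest (≤-trans (x∧y≤x f′ d′) f′≤f) (x∧y≤y f′ d′))
            (≤-trans (bound d′∈I) (∨-least (≤-trans j≤j′ (x≤x∨y j′ d)) (y≤x∨y j′ d)))
      ; glue   = λ {f} {j} b (d , d∈I , p) (e , e∈I , q) → d ∨ e , I-∨-closed L d∈I e∈I , λ {d′} d′∈I →
          let j≤   = x≤x∨y j (d ∨ e)
              d∨e≤ = y≤x∨y j (d ∨ e)
          in cut L {a = b}
            (≤-trans (∧-greatest (∧-greatest (≤-trans (x∧y≤x _ b) (x∧y≤x f d′)) (x∧y≤y _ b))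
                                 (≤-trans (x∧y≤x _ b) (x∧y≤y f d′)))
              (≤-trans (p d′∈I) (∨-least j≤ (≤-trans (x≤x∨y d e) d∨e≤))))
            (≤-trans (q d′∈I) (∨-least
              (∨-least (≤-trans j≤ (x≤x∨y _ b)) (y≤x∨y _ b))
              (≤-trans (≤-trans (y≤x∨y d e) d∨e≤) (x≤x∨y _ b))))
      }

    ⊤∖⊥-large : ¬ Small ⊤ ⊥
    ⊤∖⊥-large (d , d∈I , bound) =
      let d′ , d′∈I , d′≰d = unbounded d∈I in
      d′≰d (≤-trans (∧-greatest (maximum d′) ≤-refl) (≤-trans (bound d′∈I) (∨-least (minimum d) ≤-refl)))

    open LargePoint (large-point ideal ⊤∖⊥-large)
      using (filter; f∈; large; base; base∋; base-decreasing; base-generates)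

    -- If some b in the filter annihilated `a`, then α b would be small with b itself as the bound.
    -- So the limit is consistent with `a` and lies in ↓ (α a).
    extended : ∃ λ (G : PrimeFilter L) → (Member filter ⊆ Member G) × (a ∈ Member G)
    extended = extension filter λ {b} b∈ b∈I →
      large b∈ (proper filter) (b , b∈I , λ {d′} _ → ≤-trans (x∧y≤x b d′) (y≤x∨y ⊥ b))

    larger : ∀ n {d} → d ∈ I → ∃ λ d′ → (d′ ∈ I) × ¬ (proj₁ (base n) ∧ d′) ≤ (proj₂ (base n) ∨ d)
    larger n {d} d∈I = ⊈⇒∃ λ bound → large (proj₁ (base∋ n)) (proj₂ (base∋ n)) (d , d∈I , bound)

    -- Collects the join of all earlier witnesses: the `d′` added at stage n is by definition `w n`.
    -- A point outside α (D n) therefore avoids every `w m` with m < n.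
    accumulated : ℕ → ∃ I
    accumulated zero    = ⊥ , x∧y≤x ⊥ a
    accumulated (suc n) =
      let d , d∈I = accumulated n
          d′ , d′∈I , _ = larger n d∈I
      in (d ∨ d′) , I-∨-closed L d∈I d′∈I

    D : ℕ → Carrier
    D = proj₁ ∘ accumulated

    fresh : ∀ n → ∃ λ d′ → (d′ ∈ I) × ¬ (proj₁ (base n) ∧ d′) ≤ (proj₂ (base n) ∨ D n)
    fresh n = larger n (proj₂ (accumulated n))

    w : ℕ → Carrier
    w = proj₁ ∘ fresh

    -- Membership in the n-th basic neighbourhood of the limit gives convergence; lying in α (w n)
    -- but outside α (D n) keeps the points apart.
    separated : ∀ n → ∃ λ (F : PrimeFilter L) →
                ((proj₁ (base n) ∧ w n) ∈ Member F) × ((proj₂ (base n) ∨ D n) ∉ Member F)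
    separated n = ≰-separated (proj₂ (proj₂ (fresh n)))

    A∈𝐳 : ∀ n → proj₁ (base n) ∈ Member (proj₁ (separated n))
    A∈𝐳 n = let F , A∧w∈F , _ = separated n in upward F (x∧y≤x _ _) A∧w∈F

    w∈𝐳 : ∀ n → w n ∈ Member (proj₁ (separated n))
    w∈𝐳 n = let F , A∧w∈F , _ = separated n in upward F (x∧y≤y _ _) A∧w∈F

    B∉𝐳 : ∀ n → proj₂ (base n) ∉ Member (proj₁ (separated n))
    B∉𝐳 n = let F , _ , B∨D∉F = separated n in B∨D∉F ∘ upward F (x≤x∨y _ _)

    D∉𝐳 : ∀ n → D n ∉ Member (proj₁ (separated n))
    D∉𝐳 n = let F , _ , B∨D∉F = separated n in B∨D∉F ∘ upward F (y≤x∨y _ _)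

    w≤D : ∀ {m n} → suc m ℕ.≤′ n → w m ≤ D n
    w≤D {m} ℕ.≤′-refl = y≤x∨y (D m) (w m)
    w≤D {n = suc n} (ℕ.≤′-step m<n) = ≤-trans (w≤D m<n) (x≤x∨y (D n) (w n))

  ¬pAlgebra⇒obstruction : ¬ IsPAlgebra L → ∃ λ a → Obstruction L a
  ¬pAlgebra⇒obstruction ¬pAlgebra =
    let a , no-greatest = ¬∀⟶∃¬ ¬pAlgebra in
    a , ¬pseudocomplement⇒obstruction λ {d} d∈I → ⊈⇒∃ λ bound →
      no-greatest (d , antisym d∈I (minimum _) , λ e e∧a≈⊥ → bound (reflexive e∧a≈⊥))

corollary3p5 : (∀ {ℓ} → ExcludedMiddle ℓ) →
    ∀ {c ℓ₁ ℓ₂} (L : BoundedDistributiveLattice c ℓ₁ ℓ₂) →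
    Countable (BoundedDistributiveLattice.setoid L) →
    let X = PriestleySpace L in
    ((¬ OrderedSpace.IsPSpace X) ⇔
    (IsPConfiguration Z₁ x y X ⊎ IsPConfiguration Z₂ x y X ⊎ IsPConfiguration Z₃ x y X))
    ×
    ((¬ IsPAlgebra L) ⇔
    (IsPQuotient L L₁ c₁ ⊎ IsPQuotient L L₂ c₂ ⊎ IsPQuotient L L₃ c₃))
corollary3p5 em L countable =
  -- By the contrapositive of `isPSpace`, both halves start from the same obstruction in `L`.
  mk⇔ (λ ¬pSpace → configuration (¬pSpace ∘ isPSpace))
      [ pConfiguration⇒¬pSpace <₁-isShape
      , [ pConfiguration⇒¬pSpace <₂-isShape , pConfiguration⇒¬pSpace <₃-isShape ]′ ]′
  , mk⇔ quotient
      [ quotient⇒¬pAlgebra <₁-isShape L₁-isDual L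
      , [ quotient⇒¬pAlgebra <₂-isShape L₂-isDual L , quotient⇒¬pAlgebra <₃-isShape L₃-isDual L ]′ ]′
  where
  open Configurations em using (pConfiguration; pQuotient)
  open Dualities em
  open DualProperties using (quotient⇒¬pAlgebra)
  open PrimeFilters em L countable using (isPSpace)

  module _ (¬pAlgebra : ¬ IsPAlgebra L) where
    private
      ordered = ordered-subsequence em L (proj₂ (¬pAlgebra⇒obstruction em L countable ¬pAlgebra))

    configuration : IsPConfiguration Z₁ x y (PriestleySpace L) ⊎
                    IsPConfiguration Z₂ x y (PriestleySpace L) ⊎
                    IsPConfiguration Z₃ x y (PriestleySpace L)
    configuration = Sum.map (λ (O , o) → pConfiguration <₁-isShape L O o)
      (Sum.map (λ (O , o) → pConfiguration <₂-isShape L O o)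
               (λ (O , o) → pConfiguration <₃-isShape L O o)) ordered

    quotient : IsPQuotient L L₁ c₁ ⊎ IsPQuotient L L₂ c₂ ⊎ IsPQuotient L L₃ c₃
    quotient = Sum.map (λ (O , o) → pQuotient <₁-isShape L O o L₁-isDual)
      (Sum.map (λ (O , o) → pQuotient <₂-isShape L O o L₂-isDual)
               (λ (O , o) → pQuotient <₃-isShape L O o L₃-isDual)) ordered
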